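{- Let $\Delta$ be a flag $3$-dimensional Eulerian complex on $n$ vertices. If $f_1(\Delta)=f_1(J_2(n))$, then $\Delta\in GJ(n)$.
   Context: A simplicial complex is flag if every minimal non-face has exactly two elements. For a face $\sigma$, $\mathrm{lk}_\Delta\sigma=\{\tau-\sigma:\sigma\subseteq\tau\in\Delta\}$. The reduced Euler characteristic is $\chi(\Gamma)=\sum_i(-1)^i\beta_i(\Gamma;\mathbf{k})$. A complex $\Delta$ is Eulerian if it is pure and $\chi(\mathrm{lk}_\Delta\sigma)=(-1)^{\dim\mathrm{lk}_\Delta\sigma}$ for every face $\sigma$, including $\sigma=\emptyset$. $f_1$ counts edges. $J_2(n)$ is the join of two cycles with $\lfloor n/2\rfloor$ and $\lceil n/2\rceil$ vertices, so $f_1(J_2(n))=\lfloor n^2/4\rfloor+n$. For $n\ge 8$, $GJ(n)$ is the set of all complexes of the form $\Delta=\bigcup_{1\le i\le s,\,1\le j\le t}(C_{a_i}*C_{b_j})$, where $C_k$ denotes a cycle (circle) with $k$ vertices, all the cycles $C_{a_1},\dots,C_{a_s},C_{b_1},\dots,C_{b_t}$ have pairwise disjoint vertex sets, all $a_i,b_j\ge 4$, $\sum_i a_i=\lfloor n/2\rfloor$ and $\sum_j b_j=\lceil n/2\rceil$; equivalently, $\Delta$ is the join of a disjoint union of cycles of lengths $a_1,\dots,a_s$ with a disjoint union of cycles of lengths $b_1,\dots,b_t$. -}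

module Defs where

open import Data.Bool using (Bool; true; false; _∧_; if_then_else_)
open import Data.Nat using (ℕ; zero; suc; _≤_; _≡ᵇ_; _⊔_; _∸_; _/_)
open import Data.Fin using (Fin; toℕ)
open import Data.Fin.Subset using (Subset; inside; outside; _∈_; _⊆_; _⊂_; _∪_; _∩_; ∣_∣; ⁅_⁆)
open import Data.Vec using ([]; _∷_)
open import Data.List using (List; []; _∷_; _++_; map; filterᵇ; length; foldr; lookup)
open import Data.Nat.ListAction using (sum)
open import Data.List.Relation.Unary.All using (All)
open import Data.Integer using (ℤ; +_; -_)
open import Data.Product using (Σ; Σ-syntax; ∃; ∃-syntax; _×_)
open import Data.Sum using (_⊎_; inj₁; inj₂)
open import Function.Bundles using (_↔_; Inverse; _⇔_)
open import Relation.Binary.PropositionalEquality using (_≡_; _≢_)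
open import Data.Empty using (⊥)

-- Simplicial complexes on the vertex set Fin n, given by their
-- (decidable) face predicate.

Cx : ℕ → Set
Cx n = Subset n → Bool

allSubsets : (n : ℕ) → List (Subset n)
allSubsets zero    = [] ∷ []
allSubsets (suc n) = map (inside ∷_) (allSubsets n) ++ map (outside ∷_) (allSubsets n)

faces : ∀ {n} → Cx n → List (Subset n)
faces {n} Γ = filterᵇ Γ (allSubsets n)

-- Γ is a simplicial complex on n vertices: closed under subsets and
-- every vertex {v} is a face (so the vertex set is exactly Fin n).
IsComplex : ∀ {n} → Cx n → Set
IsComplex {n} Δ =
  (∀ (σ τ : Subset n) → σ ⊆ τ → Δ τ ≡ true → Δ σ ≡ true) ×
  (∀ (v : Fin n) → Δ ⁅ v ⁆ ≡ true)

IsFlag : ∀ {n} → Cx n → Set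
IsFlag {n} Δ =
  ∀ (σ : Subset n) → Δ σ ≡ false → (∀ τ → τ ⊂ σ → Δ τ ≡ true) → ∣ σ ∣ ≡ 2

maxSize : ∀ {n} → Cx n → ℕ
maxSize Γ = foldr _⊔_ 0 (map ∣_∣ (faces Γ))

HasDim : ∀ {n} → Cx n → ℕ → Set
HasDim {n} Δ d =
  (∃[ σ ] (Δ σ ≡ true × ∣ σ ∣ ≡ suc d)) ×
  (∀ (σ : Subset n) → Δ σ ≡ true → ∣ σ ∣ ≤ suc d)

IsFacet : ∀ {n} → Cx n → Subset n → Set
IsFacet Δ σ = Δ σ ≡ true × (∀ τ → σ ⊂ τ → Δ τ ≡ false)

IsPure : ∀ {n} → Cx n → Set
IsPure {n} Δ = ∀ (σ τ : Subset n) → IsFacet Δ σ → IsFacet Δ τ → ∣ σ ∣ ≡ ∣ τ ∣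

lk : ∀ {n} → Cx n → Subset n → Cx n
lk Δ σ τ = Δ (τ ∪ σ) ∧ (∣ τ ∩ σ ∣ ≡ᵇ 0)

-- sgn m = (-1)^(m-1), the sign of a face with m elements (dim m-1);
-- for m = 0 this is (-1)^(-1) = -1.
sgn : ℕ → ℤ
sgn zero    = - (+ 1)
sgn (suc m) = - sgn m

-- reduced Euler characteristic  χ̃(Γ) = Σ_{τ ∈ Γ} (-1)^{dim τ}
-- (= Σ_i (-1)^i β̃_i(Γ; k) by the Euler–Poincaré formula, any field k)
χ̃ : ∀ {n} → Cx n → ℤ
χ̃ Γ = foldr Data.Integer._+_ (+ 0) (map (λ τ → sgn ∣ τ ∣) (faces Γ))

IsEulerian : ∀ {n} → Cx n → Set
IsEulerian {n} Δ =
  IsPure Δ ×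
  (∀ (σ : Subset n) → Δ σ ≡ true → χ̃ (lk Δ σ) ≡ sgn (maxSize (lk Δ σ)))

f₁ : ∀ {n} → Cx n → ℕ
f₁ {n} Δ = length (filterᵇ (λ σ → Δ σ ∧ (∣ σ ∣ ≡ᵇ 2)) (allSubsets n))

next : ℕ → ℕ → ℕ
next k x = if suc x ≡ᵇ k then 0 else suc x

CycAdj : ℕ → ℕ → ℕ → Set
CycAdj k x y = next k x ≡ y ⊎ next k y ≡ x

-- vertices of the disjoint union of cycles C_{a_1} ⊔ ... ⊔ C_{a_s}
CycV : List ℕ → Set
CycV as = Σ[ i ∈ Fin (length as) ] Fin (lookup as i)

Adj : (as : List ℕ) → CycV as → CycV as → Set
Adj as (i Data.Product., p) (j Data.Product., q) =
  Σ (i ≡ j) (λ _ → CycAdj (lookup as i) (toℕ p) (toℕ q))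

-- Q (a set of vertices) is a face of the 1-dimensional complex
-- C_{a_1} ⊔ ... ⊔ C_{a_s}: at most two elements, and any two
-- distinct elements span an edge.
CUFace : (as : List ℕ) → (CycV as → Set) → Set
CUFace as Q =
  (∀ u v w → Q u → Q v → Q w → u ≡ v ⊎ v ≡ w ⊎ u ≡ w) ×
  (∀ u v → Q u → Q v → u ≢ v → Adj as u v)

JoinFace : (as bs : List ℕ) → (CycV as ⊎ CycV bs → Set) → Set
JoinFace as bs P = CUFace as (λ u → P (inj₁ u)) × CUFace bs (λ v → P (inj₂ v))

InGJ : (n : ℕ) → Cx n → Set
InGJ n Δ =
  Σ[ as ∈ List ℕ ] Σ[ bs ∈ List ℕ ]
    All (4 ≤_) as × All (4 ≤_) bs ×
    sum as ≡ n / 2 × sum bs ≡ n ∸ n / 2 ×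
    Σ[ e ∈ Fin n ↔ (CycV as ⊎ CycV bs) ]
      (∀ (σ : Subset n) →
        (Δ σ ≡ true) ⇔ JoinFace as bs (λ v → Inverse.from e v ∈ σ))

{-# OPTIONS --safe #-}
module Submission where

-- Let d be the degree function of the 1-skeleton. Every triangle lies in exactly two facets, and by the
-- Euler relation in its link a vertex v lies in 2 d(v) - 4 facets. A vertex outside a facet is adjacent to
-- at most three of its vertices, and to three in exactly four cases, so the degree sum over a facet is at
-- most 2n + 8. Summing over all facets and using (d - m)(d - m - 1) ≥ 0 with m = ⌊n/2⌋ + 2 yields
-- f₁ ≤ ⌊n²/4⌋ + n; in the case of equality every vertex is adjacent to at least two vertices of every facet.
-- In the link of a vertex v the degrees ℓ(u) = |lk uv| of the 1-skeleton then satisfy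
-- Σ (ℓ - 4)(d(v) - 2 - ℓ) = 0 with nonnegative terms, which forces some u with ℓ(u) = d(v) - 2. Choosing
-- v of maximal degree makes this symmetric in u and v. With B the set of common neighbours of u and v and
-- A its complement, each vertex of A is adjacent to each of B, and both A and B induce 2-regular
-- triangle-free graphs, that is, disjoint unions of cycles of length at least 4. Finally
-- |A| + |B| = n and |A||B| = ⌊n²/4⌋ determine the sizes.

open import Defs
import Data.Integer.Properties as ℤ
open import Algebra.Properties.AbelianGroup ℤ.+-0-abelianGroup using () renaming (∙-cancelˡ to +-cancelˡ; ∙-cancelʳ to +-cancelʳ)
import Algebra.Properties.Semiring.Sum ℤ.+-*-semiring as ℤΣ
open import Data.Bool using (Bool; true; false; _∧_; not; T)
import Data.Bool.Properties as Bool
open import Data.Bool.Solver using (module ∨-∧-Solver)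
open import Data.Fin using (Fin; zero; suc; toℕ; fromℕ<)
import Data.Fin.Properties as Fin
open import Data.Fin.Subset using (Subset; inside; outside; _∈_; _∉_; _⊂_; _∪_; _∩_; ∣_∣; ⁅_⁆) renaming (⊥ to ∅)
open import Data.Fin.Subset.Induction using (⊂-wellFounded)
import Data.Fin.Subset.Properties as Sub
open import Data.Integer.Tactic.RingSolver using (solve-∀)
open import Data.List as List using (List; []; _∷_; _++_; filterᵇ; foldr; length)
open import Data.List.Membership.Propositional using () renaming (_∈_ to _∈ᴸ_)
open import Data.List.Membership.Propositional.Properties using (∈-++⁺ˡ; ∈-++⁺ʳ; ∈-map⁺)
import Data.List.Properties as Listₚ
open import Data.List.Relation.Unary.All using (All; []; _∷_)
open import Data.List.Relation.Unary.Any using (here; there)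
open import Data.Nat as ℕ using (ℕ; zero; suc; _≡ᵇ_; _⊔_; _/_; _%_)
open import Data.Nat.Divisibility using (n∣m*n)
open import Data.Nat.DivMod using (m≡m%n+[m/n]*n; m%n<n; m*n/n≡m; +-distrib-/-∣ʳ)
open import Data.Nat.ListAction using (sum)
import Data.Nat.Properties as ℕ
import Data.Nat.Tactic.RingSolver as ℕ-Solver
open import Data.Product using (∃; _×_; _,_; proj₁; proj₂)
open import Data.Sum as Sum using (_⊎_; inj₁; inj₂; [_,_]′)
open import Data.Vec using ([]; _∷_; lookup)
open import Data.Vec.Properties using ([]=⇒lookup; lookup⇒[]=)
open import Function using (_∘_; case_of_; _↔_; mk⇔; mk↔ₛ′)
open import Induction.WellFounded using (Acc; acc)
open import Relation.Binary.PropositionalEquality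
open import Relation.Nullary using (Dec; yes; no; does; ¬_; contradiction; ¬?; _×-dec_)
open import Relation.Nullary.Decidable using (dec-true; dec-false)
open ≡-Reasoning

-- Summing degrees over all facets weights a vertex by the number of its facets, so squares of
-- degrees appear. Cauchy-Schwarz would not be sharp for odd n, where the extremal degrees are both
-- ⌊n/2⌋ + 2 and ⌊n/2⌋ + 3; a product of consecutive integers vanishes at both values and absorbs
-- the squares without loss. The same mechanism works inside a vertex link. In the extremal
-- complexes this link is the join of two points with a cycle (or a union of cycles), whose degrees
-- are 4 on the cycle and d(v) - 2 at the two poles; these are general lower and upper bounds, and
-- the first two moments of the link degrees turn out to be exactly those that force every degree to
-- be one of the two. Links in an Eulerian complex need not be spheres, and the link of an edge may
-- consist of several cycles, so the argument rests on counts rather than on topology. All counts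
-- run over ordered tuples of vertices with integer indicators: a change of viewpoint is then an
-- exchange of sums, and identities carry factors such as 2 and 6 in place of divisions.

module Sums where

  open import Data.Integer using (ℤ; +_; 0ℤ; 1ℤ; _+_; _*_; _-_; -_; _≤_; +≤+; -[1+_])

  -- Indicator values and finite integer sums

  ⟦_⟧ : Bool → ℤ
  ⟦ true ⟧  = 1ℤ
  ⟦ false ⟧ = 0ℤ

  ⟦⟧-nonneg : ∀ b → 0ℤ ≤ ⟦ b ⟧
  ⟦⟧-nonneg true  = +≤+ ℕ.z≤n
  ⟦⟧-nonneg false = +≤+ ℕ.z≤n

  ⟦⟧≤1 : ∀ b → ⟦ b ⟧ ≤ 1ℤ
  ⟦⟧≤1 true  = ℤ.≤-refl
  ⟦⟧≤1 false = +≤+ ℕ.z≤n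

  ⟦⟧-∧ : ∀ p q → ⟦ p ∧ q ⟧ ≡ ⟦ p ⟧ * ⟦ q ⟧
  ⟦⟧-∧ true  q = sym (ℤ.*-identityˡ ⟦ q ⟧)
  ⟦⟧-∧ false q = refl

  ⟦⟧≡1⇒true : ∀ {b} → ⟦ b ⟧ ≡ 1ℤ → b ≡ true
  ⟦⟧≡1⇒true {true} _ = refl

  ⟦⟧-*-cong : ∀ b {i j} → (b ≡ true → i ≡ j) → ⟦ b ⟧ * i ≡ ⟦ b ⟧ * j
  ⟦⟧-*-cong true  i≡j = cong (1ℤ *_) (i≡j refl)
  ⟦⟧-*-cong false i≡j = refl

  ⟦⟧-*-mono : ∀ b {i j} → (b ≡ true → i ≤ j) → ⟦ b ⟧ * i ≤ ⟦ b ⟧ * j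
  ⟦⟧-*-mono true  i≤j = ℤ.*-monoˡ-≤-nonNeg 1ℤ (i≤j refl)
  ⟦⟧-*-mono false i≤j = ℤ.≤-refl

  ∧-true : ∀ {p q} → p ∧ q ≡ true → p ≡ true × q ≡ true
  ∧-true {true} {true} _ = refl , refl

  true-∧ : ∀ {p q} → p ≡ true → q ≡ true → p ∧ q ≡ true
  true-∧ refl refl = refl

  +-cancelʳ-≤ : ∀ {i j} k → i + k ≤ j + k → i ≤ j
  +-cancelʳ-≤ {i} {j} k i+k≤j+k = subst₂ _≤_ (lemma i k) (lemma j k) (ℤ.+-monoˡ-≤ (- k) i+k≤j+k)
    where
    lemma : ∀ i k → i + k + - k ≡ i
    lemma = solve-∀

  -- Opacity keeps ∑ f rigid, so that f can be inferred by unification.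
  opaque
    ∑ : ∀ {n} → (Fin n → ℤ) → ℤ
    ∑ = ℤΣ.sum

    ∑-cong : ∀ {n} {f g : Fin n → ℤ} → (∀ i → f i ≡ g i) → ∑ f ≡ ∑ g
    ∑-cong = ℤΣ.sum-cong-≗

    ∑-+ : ∀ {n} (f g : Fin n → ℤ) → ∑ (λ i → f i + g i) ≡ ∑ f + ∑ g
    ∑-+ = ℤΣ.∑-distrib-+

    ∑-*ˡ : ∀ {n} c (f : Fin n → ℤ) → c * ∑ f ≡ ∑ (λ i → c * f i)
    ∑-*ˡ = ℤΣ.*-distribˡ-sum

    ∑-*ʳ : ∀ {n} c (f : Fin n → ℤ) → ∑ f * c ≡ ∑ (λ i → f i * c)
    ∑-*ʳ = ℤΣ.*-distribʳ-sum

    ∑-comm : ∀ {m n} (f : Fin m → Fin n → ℤ) → ∑ (λ i → ∑ (f i)) ≡ ∑ (λ j → ∑ λ i → f i j)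
    ∑-comm = ℤΣ.∑-comm

    ∑-[] : ∀ {f : Fin 0 → ℤ} → ∑ f ≡ 0ℤ
    ∑-[] = refl

    ∑-∷ : ∀ {n} (f : Fin (suc n) → ℤ) → ∑ f ≡ f zero + ∑ (f ∘ suc)
    ∑-∷ f = refl

    ∑-const : ∀ {n} c → ∑ (λ (_ : Fin n) → c) ≡ + n * c
    ∑-const {zero}  c = refl
    ∑-const {suc n} c = trans (cong (λ i → c + i) (∑-const {n} c)) (sym (ℤ.suc-* (+ n) c))

    ∑-mono : ∀ {n} {f g : Fin n → ℤ} → (∀ i → f i ≤ g i) → ∑ f ≤ ∑ g
    ∑-mono {zero}  f≤g = ℤ.≤-refl
    ∑-mono {suc n} f≤g = ℤ.+-mono-≤ (f≤g zero) (∑-mono (f≤g ∘ suc))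

  ∑-zero : ∀ {n} {f : Fin n → ℤ} → (∀ i → f i ≡ 0ℤ) → ∑ f ≡ 0ℤ
  ∑-zero {n} f≡0 = trans (∑-cong f≡0) (trans (∑-const {n} 0ℤ) (ℤ.*-zeroʳ (+ n)))

  ∑-nonneg : ∀ {n} {f : Fin n → ℤ} → (∀ i → 0ℤ ≤ f i) → 0ℤ ≤ ∑ f
  ∑-nonneg 0≤f = ℤ.≤-trans (ℤ.≤-reflexive (sym (∑-zero λ _ → refl))) (∑-mono 0≤f)

  -- The tails compare the same way as the heads, so equal totals leave no room for a strict
  -- inequality at the head. This turns equality in a summed estimate into information about each
  -- facet, edge or vertex.
  ∑-mono-≡ : ∀ {n} {f g : Fin n → ℤ} → (∀ i → f i ≤ g i) → ∑ f ≡ ∑ g → ∀ i → f i ≡ g i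
  ∑-mono-≡ {suc n} {f} {g} f≤g ∑f≡∑g = λ { zero → head-≡ ; (suc i) → ∑-mono-≡ (f≤g ∘ suc) tail-≡ i }
    where
    eq : f zero + ∑ (f ∘ suc) ≡ g zero + ∑ (g ∘ suc)
    eq = trans (sym (∑-∷ f)) (trans ∑f≡∑g (∑-∷ g))
    head-≡ : f zero ≡ g zero
    head-≡ = ℤ.≤-antisym (f≤g zero)
      (+-cancelʳ-≤ (∑ (f ∘ suc)) (ℤ.≤-trans (ℤ.+-monoʳ-≤ (g zero) (∑-mono (f≤g ∘ suc))) (ℤ.≤-reflexive (sym eq))))
    tail-≡ : ∑ (f ∘ suc) ≡ ∑ (g ∘ suc)
    tail-≡ = trans (sym (lemma (f zero) _)) (trans (cong₂ (λ i j → - i + j) head-≡ eq) (lemma (g zero) _))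
      where
      lemma : ∀ i k → - i + (i + k) ≡ k
      lemma = solve-∀

  ∑-nonneg-≡0 : ∀ {n} {f : Fin n → ℤ} → (∀ i → 0ℤ ≤ f i) → ∑ f ≡ 0ℤ → ∀ i → f i ≡ 0ℤ
  ∑-nonneg-≡0 0≤f eq i = sym (∑-mono-≡ 0≤f (trans (∑-zero λ _ → refl) (sym eq)) i)

  ∑-+₃ : ∀ {n} (f g h : Fin n → ℤ) → ∑ (λ i → f i + g i + h i) ≡ ∑ f + ∑ g + ∑ h
  ∑-+₃ f g h = trans (∑-+ (λ i → f i + g i) h) (cong (_+ ∑ h) (∑-+ f g))

  ∑-+₄ : ∀ {n} (f g h k : Fin n → ℤ) → ∑ (λ i → f i + g i + h i + k i) ≡ ∑ f + ∑ g + ∑ h + ∑ k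
  ∑-+₄ f g h k = trans (∑-+ (λ i → f i + g i + h i) k) (cong (_+ ∑ k) (∑-+₃ f g h))

  ∑-δ : ∀ {n} (j : Fin n) → ∑ (λ i → ⟦ does (i Fin.≟ j) ⟧) ≡ 1ℤ
  ∑-δ {suc n} zero    = trans (∑-∷ _) (cong (λ i → 1ℤ + i) (∑-zero λ _ → refl))
  ∑-δ {suc n} (suc j) = trans (∑-∷ _) (trans (ℤ.+-identityˡ _) (∑-δ j))

  ∑-swap : ∀ {n} (H : Fin n → Fin n → ℤ) (g : Fin n → ℤ) → (∀ i j → H i j ≡ H j i) →
           ∑ (λ i → ∑ λ j → H i j * g j) ≡ ∑ (λ i → ∑ λ j → H i j * g i)
  ∑-swap H g H-sym = trans (∑-comm λ i j → H i j * g j)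
    (∑-cong λ j → ∑-cong λ i → cong (_* g j) (H-sym i j))

  any : ∀ {n} (p : Fin n → Bool) → (∃ λ i → p i ≡ true) ⊎ (∀ i → p i ≡ false)
  any p with Fin.any? (λ i → p i Bool.≟ true)
  ... | yes found = inj₁ found
  ... | no  none  = inj₂ λ i → Bool.¬-not λ pi → none (i , pi)

  count : ∀ {n} → (Fin n → Bool) → ℤ
  count p = ∑ λ i → ⟦ p i ⟧

  count-positive : ∀ {n} (p : Fin n → Bool) → count p ≢ 0ℤ → ∃ λ i → p i ≡ true
  count-positive p ≢0 with any p
  ... | inj₁ found = found
  ... | inj₂ none  = contradiction (∑-zero λ i → cong ⟦_⟧ (none i)) ≢0

  -- In a 2-regular graph this continues a walk: `y` is the vertex just left and `z` the next one.
  count≡2 : ∀ {n} (p : Fin n → Bool) → count p ≡ + 2 → ∀ y → p y ≡ true →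
            ∃ λ z → p z ≡ true × z ≢ y × (∀ w → p w ≡ true → w ≡ y ⊎ w ≡ z)
  count≡2 p p≡2 y py with any (λ z → p z ∧ not (does (z Fin.≟ y)))
  ... | inj₂ none = contradiction (trans (sym p≡2) (trans (∑-cong only) (∑-δ y))) λ ()
    where
    only : ∀ z → ⟦ p z ⟧ ≡ ⟦ does (z Fin.≟ y) ⟧
    only z with z Fin.≟ y | none z
    ... | yes refl | _ rewrite py = refl
    ... | no  _    | eq = cong ⟦_⟧ (trans (sym (Bool.∧-identityʳ (p z))) eq)
  ... | inj₁ (z , pz∧) with z Fin.≟ y | ∧-true {p z} pz∧
  ...   | yes _  | _ , ()
  ...   | no z≢y | pz , _ = z , pz , z≢y , cover
    where
    cover : ∀ w → p w ≡ true → w ≡ y ⊎ w ≡ z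
    cover w pw with w Fin.≟ y | w Fin.≟ z
    ... | yes w≡y | _       = inj₁ w≡y
    ... | no  _   | yes w≡z = inj₂ w≡z
    -- Point masses at three distinct solutions lie below `p`, which would give 3 ≤ 2.
    ... | no w≢y  | no w≢z  = contradiction (subst₂ _≤_ three p≡2 (∑-mono distinct)) λ { (+≤+ (ℕ.s≤s (ℕ.s≤s ()))) }
      where
      three : ∑ (λ i → ⟦ does (i Fin.≟ y) ⟧ + ⟦ does (i Fin.≟ z) ⟧ + ⟦ does (i Fin.≟ w) ⟧) ≡ + 3
      three = trans (∑-+₃ (λ i → ⟦ does (i Fin.≟ y) ⟧) _ _) (cong₂ _+_ (cong₂ _+_ (∑-δ y) (∑-δ z)) (∑-δ w))
      distinct : ∀ i → ⟦ does (i Fin.≟ y) ⟧ + ⟦ does (i Fin.≟ z) ⟧ + ⟦ does (i Fin.≟ w) ⟧ ≤ ⟦ p i ⟧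
      distinct i with i Fin.≟ y | i Fin.≟ z | i Fin.≟ w
      ... | yes refl | yes refl | _        = contradiction refl z≢y
      ... | yes refl | no _     | yes refl = contradiction refl w≢y
      ... | yes refl | no _     | no _     rewrite py = ℤ.≤-refl
      ... | no _     | yes refl | yes refl = contradiction refl w≢z
      ... | no _     | yes refl | no _     rewrite pz = ℤ.≤-refl
      ... | no _     | no _     | yes refl rewrite pw = ℤ.≤-refl
      ... | no _     | no _     | no _     = ⟦⟧-nonneg (p i)

open Sums

-- Counting in the 1-skeleton

module FacetCounting where

  open import Data.Integer using (ℤ; +_; 0ℤ; 1ℤ; _+_; _*_; _-_; -_; _≤_; +≤+; -[1+_])

  ∑-⟦∧⟧ : ∀ {n} p (q : Fin n → Bool) c → (p ≡ true → ∑ (λ i → ⟦ q i ⟧) ≡ c) → ∑ (λ i → ⟦ p ∧ q i ⟧) ≡ ⟦ p ⟧ * c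
  ∑-⟦∧⟧ p q c eq = trans (∑-cong λ i → ⟦⟧-∧ p (q i)) (trans (sym (∑-*ˡ ⟦ p ⟧ (⟦_⟧ ∘ q))) (⟦⟧-*-cong p eq))

  ⟦⟧-*-true : ∀ {b} i → b ≡ true → ⟦ b ⟧ * i ≡ i
  ⟦⟧-*-true i refl = ℤ.*-identityˡ i

  ⟦⟧-split : ∀ p q → ⟦ p ⟧ ≡ ⟦ p ∧ q ⟧ + ⟦ p ∧ not q ⟧
  ⟦⟧-split true  true  = refl
  ⟦⟧-split true  false = refl
  ⟦⟧-split false _     = refl

  count-split : ∀ {n} (p q : Fin n → Bool) → count p ≡ count (λ i → p i ∧ q i) + count (λ i → p i ∧ not (q i))
  count-split p q = trans (∑-cong λ i → ⟦⟧-split (p i) (q i)) (∑-+ _ _)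

  does-true : ∀ {P : Set} (P? : Dec P) → does P? ≡ true → P
  does-true (yes p) _ = p

  ∧-implied : ∀ p q → (q ≡ true → p ≡ true) → p ∧ q ≡ q
  ∧-implied p true  q⇒p rewrite q⇒p refl = refl
  ∧-implied p false q⇒p = Bool.∧-zeroʳ p

  -- Two consecutive integers never have strictly opposite signs. Integrality is essential: the
  -- product is negative for real k strictly between 0 and 1.
  pronic-nonneg : ∀ k → 0ℤ ≤ k * (k - 1ℤ)
  pronic-nonneg (+ zero)  = +≤+ ℕ.z≤n
  pronic-nonneg (+ suc k) = subst (0ℤ ≤_) (ℤ.pos-* (suc k) k) (+≤+ ℕ.z≤n)
  pronic-nonneg -[1+ k ]  = +≤+ ℕ.z≤n

  0≤i+j≡0⇒i≡0 : ∀ {i j} → 0ℤ ≤ i → 0ℤ ≤ j → i + j ≡ 0ℤ → i ≡ 0ℤ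
  0≤i+j≡0⇒i≡0 {i} {j} 0≤i 0≤j eq = ℤ.≤-antisym
    (ℤ.≤-trans (ℤ.≤-reflexive (sym (ℤ.+-identityʳ i))) (ℤ.≤-trans (ℤ.+-monoʳ-≤ i 0≤j) (ℤ.≤-reflexive eq))) 0≤i

  *-nonneg : ∀ {i j} → 0ℤ ≤ i → 0ℤ ≤ j → 0ℤ ≤ i * j
  *-nonneg {+ i} {+ j} _ _ = subst (0ℤ ≤_) (ℤ.pos-* i j) (+≤+ ℕ.z≤n)
  *-nonneg { -[1+ _ ]} ()
  *-nonneg {+ _} { -[1+ _ ]} _ ()

  argmax : ∀ {n} (f : Fin n → ℤ) → Fin n → ∃ λ i → ∀ j → f j ≤ f i
  argmax {suc zero}    f _ = zero , λ { zero → ℤ.≤-refl }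
  argmax {suc (suc n)} f _ with argmax (f ∘ suc) zero
  ... | i , max with ℤ.≤-total (f zero) (f (suc i))
  ...   | inj₁ f0≤fi = suc i , λ { zero → f0≤fi ; (suc j) → max j }
  ...   | inj₂ fi≤f0 = zero , λ { zero → ℤ.≤-refl ; (suc j) → ℤ.≤-trans (max j) fi≤f0 }

  -- For a facet v, u, x, y without a common neighbour, the completions of vux and those of vuy are
  -- disjoint sets of common neighbours of v and u. With two completions each, the codegree is at
  -- least 4.
  two-of-three-≤ : ∀ p q r s → p ∧ q ∧ r ∧ s ≡ false → ⟦ p ∧ q ∧ r ⟧ + ⟦ p ∧ q ∧ s ⟧ ≤ ⟦ p ∧ q ⟧
  two-of-three-≤ true  true  true  true  ()
  two-of-three-≤ true  true  true  false _ = ℤ.≤-refl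
  two-of-three-≤ true  true  false true  _ = ℤ.≤-refl
  two-of-three-≤ true  true  false false _ = +≤+ ℕ.z≤n
  two-of-three-≤ true  false _     _     _ = ℤ.≤-refl
  two-of-three-≤ false _     _     _     _ = ℤ.≤-refl

  -- For a facet v, u, x, y the two completions of vxy are neighbours of v that are not adjacent to
  -- u, so the codegree of v and u is at most the degree of v minus 2.
  opposite-≤ : ∀ p q r s → p ∧ q ∧ r ∧ s ≡ false → ⟦ p ∧ q ⟧ + ⟦ p ∧ r ∧ s ⟧ ≤ ⟦ p ⟧
  opposite-≤ false _     _     _     _ = ℤ.≤-refl
  opposite-≤ true  true  true  true  ()
  opposite-≤ true  true  true  false _ = ℤ.≤-refl
  opposite-≤ true  true  false _     _ = ℤ.≤-refl
  opposite-≤ true  false true  true  _ = ℤ.≤-refl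
  opposite-≤ true  false true  false _ = +≤+ ℕ.z≤n
  opposite-≤ true  false false _     _ = +≤+ ℕ.z≤n

  -- p, q, r, s tell to which vertices of a facet a vertex w is adjacent. Summed over all w, the triple
  -- products give 8, since each of the four triangles of the facet has two completions to a facet.
  slack : Bool → Bool → Bool → Bool → ℤ
  slack p q r s =
    + 2 + (⟦ p ∧ q ∧ r ⟧ + ⟦ p ∧ q ∧ s ⟧ + ⟦ p ∧ r ∧ s ⟧ + ⟦ q ∧ r ∧ s ⟧) - (⟦ p ⟧ + ⟦ q ⟧ + ⟦ r ⟧ + ⟦ s ⟧)

  -- With k of the four Booleans true the value is 2 + C(k,3) - k, that is 2, 1, 0, 0, 2 for k = 0,
  -- 1, 2, 3, 4. Value 0 therefore means k = 2 or k = 3.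
  slack-nonneg : ∀ p q r s → 0ℤ ≤ slack p q r s
  slack-nonneg true  true  true  true  = +≤+ ℕ.z≤n
  slack-nonneg true  true  true  false = +≤+ ℕ.z≤n
  slack-nonneg true  true  false true  = +≤+ ℕ.z≤n
  slack-nonneg true  true  false false = +≤+ ℕ.z≤n
  slack-nonneg true  false true  true  = +≤+ ℕ.z≤n
  slack-nonneg true  false true  false = +≤+ ℕ.z≤n
  slack-nonneg true  false false true  = +≤+ ℕ.z≤n
  slack-nonneg true  false false false = +≤+ ℕ.z≤n
  slack-nonneg false true  true  true  = +≤+ ℕ.z≤n
  slack-nonneg false true  true  false = +≤+ ℕ.z≤n
  slack-nonneg false true  false true  = +≤+ ℕ.z≤n
  slack-nonneg false true  false false = +≤+ ℕ.z≤n
  slack-nonneg false false true  true  = +≤+ ℕ.z≤n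
  slack-nonneg false false true  false = +≤+ ℕ.z≤n
  slack-nonneg false false false true  = +≤+ ℕ.z≤n
  slack-nonneg false false false false = +≤+ ℕ.z≤n

  two-of-three-≤-not : ∀ p q r s → p ∧ q ∧ r ∧ s ≡ false → ⟦ p ∧ r ∧ s ⟧ ≤ ⟦ p ∧ not q ⟧
  two-of-three-≤-not false _     _     _     _ = ℤ.≤-refl
  two-of-three-≤-not true  true  true  true  ()
  two-of-three-≤-not true  true  true  false _ = ℤ.≤-refl
  two-of-three-≤-not true  true  false _     _ = ℤ.≤-refl
  two-of-three-≤-not true  false r     s     _ = ⟦⟧≤1 (r ∧ s)

  -- For a neighbour w of the first facet vertex, let k of the other three be adjacent to w. Zero
  -- slack gives k ≥ 1, the absence of a 5-clique gives k ≤ 2, and for these values k = 1 + C(k,2).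
  slack≡0⇒link-count : ∀ p q r s → slack p q r s ≡ 0ℤ → p ∧ q ∧ r ∧ s ≡ false →
    ⟦ p ∧ q ⟧ + ⟦ p ∧ r ⟧ + ⟦ p ∧ s ⟧ ≡ ⟦ p ⟧ + ⟦ p ∧ q ∧ r ⟧ + ⟦ p ∧ q ∧ s ⟧ + ⟦ p ∧ r ∧ s ⟧
  slack≡0⇒link-count false _     _     _     _ _ = refl
  slack≡0⇒link-count true  true  true  true  _ ()
  slack≡0⇒link-count true  true  true  false _ _ = refl
  slack≡0⇒link-count true  true  false true  _ _ = refl
  slack≡0⇒link-count true  true  false false _ _ = refl
  slack≡0⇒link-count true  false true  true  _ _ = refl
  slack≡0⇒link-count true  false true  false _ _ = refl
  slack≡0⇒link-count true  false false true  _ _ = refl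

  slack≡0⇒both : ∀ r s → slack false false r s ≡ 0ℤ → r ≡ true
  slack≡0⇒both true _ _ = refl
  slack≡0⇒both false true ()
  slack≡0⇒both false false ()

  -- Ordered cliques and degree sums over facets

  module Counting {n : ℕ} (E : Fin n → Fin n → Bool) (E-sym : ∀ a b → E a b ≡ E b a) where

    deg : Fin n → ℤ
    deg v = count (E v)

    codeg : Fin n → Fin n → ℤ
    codeg u v = count λ w → E u w ∧ E v w

    clique₃ : Fin n → Fin n → Fin n → Bool
    clique₃ a b c = E a b ∧ E a c ∧ E b c

    clique₄ : Fin n → Fin n → Fin n → Fin n → Bool
    clique₄ a b c d = clique₃ a b c ∧ E a d ∧ E b d ∧ E c d

    module Closed (triangle-two : ∀ a b c → clique₃ a b c ≡ true → count (λ w → E a w ∧ E b w ∧ E c w) ≡ + 2)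
      where

      clique₃-swap : ∀ v a b → clique₃ v a b ≡ clique₃ v b a
      clique₃-swap v a b rewrite E-sym b a =
        ∨-∧-Solver.solve 3 (λ x y z → x :* (y :* z) := y :* (x :* z)) refl (E v a) (E v b) (E a b)
        where open ∨-∧-Solver using (_:*_; _:=_)

      clique₃-rotate : ∀ v a b → clique₃ v a b ≡ clique₃ a v b
      clique₃-rotate v a b rewrite E-sym a v =
        ∨-∧-Solver.solve 3 (λ x y z → x :* (y :* z) := x :* (z :* y)) refl (E v a) (E v b) (E a b)
        where open ∨-∧-Solver using (_:*_; _:=_)

      clique₄-swap : ∀ v a b c → clique₄ v a b c ≡ clique₄ v a c b
      clique₄-swap v a b c rewrite E-sym c b =
        ∨-∧-Solver.solve 6 (λ va vb ab vc ac bc →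
          (va :* (vb :* ab)) :* (vc :* (ac :* bc)) := (va :* (vc :* ac)) :* (vb :* (ab :* bc)))
          refl (E v a) (E v b) (E a b) (E v c) (E a c) (E b c)
        where open ∨-∧-Solver using (_:*_; _:=_)

      t : Fin n → Fin n → ℤ
      t v a = ∑ λ b → ⟦ clique₃ v a b ⟧

      T₃ : Fin n → ℤ
      T₃ v = ∑ (t v)

      t-sym : ∀ v a → t v a ≡ t a v
      t-sym v a = ∑-cong λ b → cong ⟦_⟧ (clique₃-rotate v a b)

      t≡codeg : ∀ v a → t v a ≡ ⟦ E v a ⟧ * codeg v a
      t≡codeg v a = ∑-⟦∧⟧ (E v a) (λ b → E v b ∧ E a b) _ λ _ → refl

      ∑-clique₄ : ∀ v a b k → ∑ (λ c → ⟦ clique₄ v a b c ⟧ * k) ≡ + 2 * (⟦ clique₃ v a b ⟧ * k)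
      ∑-clique₄ v a b k = begin
        ∑ (λ c → ⟦ clique₄ v a b c ⟧ * k) ≡⟨ ∑-*ʳ k _ ⟨
        ∑ (λ c → ⟦ clique₄ v a b c ⟧) * k ≡⟨ cong (_* k) (∑-⟦∧⟧ (clique₃ v a b) _ _ (triangle-two v a b)) ⟩
        ⟦ clique₃ v a b ⟧ * + 2 * k       ≡⟨ lemma ⟦ clique₃ v a b ⟧ k ⟩
        + 2 * (⟦ clique₃ v a b ⟧ * k)     ∎
        where
        lemma : ∀ x k → x * + 2 * k ≡ + 2 * (x * k)
        lemma = solve-∀

      ∑-clique₄-first : ∀ v (h : Fin n → ℤ) →
        ∑ (λ a → ∑ λ b → ∑ λ c → ⟦ clique₄ v a b c ⟧ * h a) ≡ + 2 * ∑ (λ a → t v a * h a)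
      ∑-clique₄-first v h = trans
        (∑-cong λ a → begin
          ∑ (λ b → ∑ λ c → ⟦ clique₄ v a b c ⟧ * h a) ≡⟨ ∑-cong (λ b → ∑-clique₄ v a b (h a)) ⟩
          ∑ (λ b → + 2 * (⟦ clique₃ v a b ⟧ * h a))   ≡⟨ ∑-*ˡ (+ 2) _ ⟨
          + 2 * ∑ (λ b → ⟦ clique₃ v a b ⟧ * h a)     ≡⟨ cong (+ 2 *_) (∑-*ʳ (h a) _) ⟨
          + 2 * (t v a * h a)                         ∎)
        (sym (∑-*ˡ (+ 2) _))

      ∑-clique₄-second : ∀ v (h : Fin n → ℤ) →
        ∑ (λ a → ∑ λ b → ∑ λ c → ⟦ clique₄ v a b c ⟧ * h b) ≡ + 2 * ∑ (λ a → t v a * h a)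
      ∑-clique₄-second v h = begin
        ∑ (λ a → ∑ λ b → ∑ λ c → ⟦ clique₄ v a b c ⟧ * h b)
          ≡⟨ ∑-cong (λ a → ∑-cong λ b → ∑-clique₄ v a b (h b)) ⟩
        ∑ (λ a → ∑ λ b → + 2 * (⟦ clique₃ v a b ⟧ * h b))
          ≡⟨ ∑-cong (λ a → ∑-*ˡ (+ 2) _) ⟨
        ∑ (λ a → + 2 * ∑ λ b → ⟦ clique₃ v a b ⟧ * h b)
          ≡⟨ ∑-*ˡ (+ 2) _ ⟨
        + 2 * ∑ (λ a → ∑ λ b → ⟦ clique₃ v a b ⟧ * h b)
          ≡⟨ cong (+ 2 *_) (∑-swap (λ a b → ⟦ clique₃ v a b ⟧) h λ a b → cong ⟦_⟧ (clique₃-swap v a b)) ⟩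
        + 2 * ∑ (λ a → ∑ λ b → ⟦ clique₃ v a b ⟧ * h a)
          ≡⟨ cong (+ 2 *_) (∑-cong λ a → ∑-*ʳ (h a) _) ⟨
        + 2 * ∑ (λ a → t v a * h a) ∎

      ∑-clique₄-third : ∀ v (h : Fin n → ℤ) →
        ∑ (λ a → ∑ λ b → ∑ λ c → ⟦ clique₄ v a b c ⟧ * h c) ≡ + 2 * ∑ (λ a → t v a * h a)
      ∑-clique₄-third v h = trans
        (∑-cong λ a → ∑-swap (λ b c → ⟦ clique₄ v a b c ⟧) h λ b c → cong ⟦_⟧ (clique₄-swap v a b c))
        (∑-clique₄-second v h)

      ∑³-cong : ∀ {f g : Fin n → Fin n → Fin n → ℤ} → (∀ a b c → f a b c ≡ g a b c) →
        ∑ (λ a → ∑ λ b → ∑ λ c → f a b c) ≡ ∑ (λ a → ∑ λ b → ∑ λ c → g a b c)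
      ∑³-cong f≡g = ∑-cong λ a → ∑-cong λ b → ∑-cong λ c → f≡g a b c

      ∑³-+ : ∀ (f g : Fin n → Fin n → Fin n → ℤ) →
        ∑ (λ a → ∑ λ b → ∑ λ c → f a b c + g a b c) ≡
        ∑ (λ a → ∑ λ b → ∑ λ c → f a b c) + ∑ (λ a → ∑ λ b → ∑ λ c → g a b c)
      ∑³-+ f g = trans (∑-cong λ a → trans (∑-cong λ b → ∑-+ (f a b) (g a b)) (∑-+ _ _)) (∑-+ _ _)

      -- The 6 is three positions times two completions: fixing the position whose weight is taken,
      -- the triangle formed with `v` and one of the remaining vertices extends in two ways.
      ∑-clique₄-sum : ∀ v (h : Fin n → ℤ) →
        ∑ (λ a → ∑ λ b → ∑ λ c → ⟦ clique₄ v a b c ⟧ * (h a + h b + h c)) ≡ + 6 * ∑ (λ a → t v a * h a)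
      ∑-clique₄-sum v h = begin
        ∑ (λ a → ∑ λ b → ∑ λ c → ⟦ clique₄ v a b c ⟧ * (h a + h b + h c))
          ≡⟨ ∑³-cong (λ a b c → expand ⟦ clique₄ v a b c ⟧ (h a) (h b) (h c)) ⟩
        ∑ (λ a → ∑ λ b → ∑ λ c → K a b c * h a + K a b c * h b + K a b c * h c)
          ≡⟨ ∑³-+ _ _ ⟩
        ∑ (λ a → ∑ λ b → ∑ λ c → K a b c * h a + K a b c * h b) + ∑ (λ a → ∑ λ b → ∑ λ c → K a b c * h c)
          ≡⟨ cong₂ _+_ (trans (∑³-+ _ _) (cong₂ _+_ (∑-clique₄-first v h) (∑-clique₄-second v h))) (∑-clique₄-third v h) ⟩
        + 2 * S + + 2 * S + + 2 * S ≡⟨ collect S ⟩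
        + 6 * S ∎
        where
        K : Fin n → Fin n → Fin n → ℤ
        K a b c = ⟦ clique₄ v a b c ⟧
        S = ∑ λ a → t v a * h a
        expand : ∀ k x y z → k * (x + y + z) ≡ k * x + k * y + k * z
        expand = solve-∀
        collect : ∀ s → + 2 * s + + 2 * s + + 2 * s ≡ + 6 * s
        collect = solve-∀

      ∑-clique₄-const : ∀ v k → ∑ (λ a → ∑ λ b → ∑ λ c → ⟦ clique₄ v a b c ⟧ * k) ≡ + 2 * (T₃ v * k)
      ∑-clique₄-const v k = trans (∑-clique₄-first v λ _ → k) (cong (+ 2 *_) (sym (∑-*ʳ k (t v))))

      Slack : Fin n → Fin n → Fin n → Fin n → ℤ
      Slack a b c d = ∑ λ w → slack (E a w) (E b w) (E c w) (E d w)

      ∑-slack : ∀ a b c d → clique₄ a b c d ≡ true →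
        Slack a b c d + (deg a + (deg b + deg c + deg d)) ≡ + 2 * + n + + 8
      ∑-slack a b c d K with ∧-true {clique₃ a b c} K
      ... | abc , abcd = begin
        Slack a b c d + (deg a + (deg b + deg c + deg d))
          ≡⟨ cong (λ x → Slack a b c d + x) (trans (lemma₁ (deg a) _ _ _) (sym (∑-+₄ _ _ _ _))) ⟩
        Slack a b c d + ∑ (λ w → ⟦ E a w ⟧ + ⟦ E b w ⟧ + ⟦ E c w ⟧ + ⟦ E d w ⟧)
          ≡⟨ ∑-+ _ _ ⟨
        ∑ (λ w → slack (E a w) (E b w) (E c w) (E d w) + (⟦ E a w ⟧ + ⟦ E b w ⟧ + ⟦ E c w ⟧ + ⟦ E d w ⟧))
          ≡⟨ ∑-cong (λ w → lemma₂ (+ 2 + e₃ w) (s w)) ⟩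
        ∑ (λ w → + 2 + (⟦ E a w ∧ E b w ∧ E c w ⟧ + ⟦ E a w ∧ E b w ∧ E d w ⟧
                        + ⟦ E a w ∧ E c w ∧ E d w ⟧ + ⟦ E b w ∧ E c w ∧ E d w ⟧))
          ≡⟨ ∑-+ _ _ ⟩
        ∑ (λ (w : Fin n) → + 2) + ∑ (λ w → ⟦ E a w ∧ E b w ∧ E c w ⟧ + ⟦ E a w ∧ E b w ∧ E d w ⟧
                        + ⟦ E a w ∧ E c w ∧ E d w ⟧ + ⟦ E b w ∧ E c w ∧ E d w ⟧)
          ≡⟨ cong₂ _+_ (trans (∑-const {n} (+ 2)) (ℤ.*-comm (+ n) (+ 2))) (trans (∑-+₄ _ _ _ _)
              (cong₂ _+_ (cong₂ _+_ (cong₂ _+_ (triangle-two a b c abc)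
                (triangle-two a b d (true-∧ ab (true-∧ ad bd))))
                (triangle-two a c d (true-∧ ac (true-∧ ad cd))))
                (triangle-two b c d (true-∧ bc (true-∧ bd cd))))) ⟩
        + 2 * + n + + 8 ∎
        where
        ab = proj₁ (∧-true {E a b} abc)
        ac = proj₁ (∧-true {E a c} (proj₂ (∧-true {E a b} abc)))
        bc = proj₂ (∧-true {E a c} (proj₂ (∧-true {E a b} abc)))
        ad = proj₁ (∧-true {E a d} abcd)
        bd = proj₁ (∧-true {E b d} (proj₂ (∧-true {E a d} abcd)))
        cd = proj₂ (∧-true {E b d} (proj₂ (∧-true {E a d} abcd)))
        e₃ s : Fin n → ℤ
        e₃ w = ⟦ E a w ∧ E b w ∧ E c w ⟧ + ⟦ E a w ∧ E b w ∧ E d w ⟧ + ⟦ E a w ∧ E c w ∧ E d w ⟧ + ⟦ E b w ∧ E c w ∧ E d w ⟧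
        s w = ⟦ E a w ⟧ + ⟦ E b w ⟧ + ⟦ E c w ⟧ + ⟦ E d w ⟧
        lemma₁ : ∀ x y z w → x + (y + z + w) ≡ x + y + z + w
        lemma₁ = solve-∀
        lemma₂ : ∀ x y → x - y + y ≡ x
        lemma₂ = solve-∀

      totalSlack : Fin n → ℤ
      totalSlack v = ∑ λ a → ∑ λ b → ∑ λ c → ⟦ clique₄ v a b c ⟧ * Slack v a b c

      -- This is `∑-slack` summed over the 2 `T₃ v` ordered facets with first vertex `v`. The degree
      -- of `v` is the same in all of them, while the other three degrees are collected by
      -- `∑-clique₄-sum`.
      totalSlack-eq : ∀ v → totalSlack v + (+ 2 * (T₃ v * deg v) + + 6 * ∑ (λ a → t v a * deg a)) ≡ + 2 * (T₃ v * (+ 2 * + n + + 8))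
      totalSlack-eq v = begin
        totalSlack v + (+ 2 * (T₃ v * deg v) + + 6 * ∑ (λ a → t v a * deg a))
          ≡⟨ cong (λ x → totalSlack v + x) (cong₂ _+_ (∑-clique₄-const v (deg v)) (∑-clique₄-sum v deg)) ⟨
        totalSlack v + (∑ (λ a → ∑ λ b → ∑ λ c → K a b c * deg v) + ∑ (λ a → ∑ λ b → ∑ λ c → K a b c * degs a b c))
          ≡⟨ cong (λ x → totalSlack v + x) (∑³-+ _ _) ⟨
        totalSlack v + ∑ (λ a → ∑ λ b → ∑ λ c → K a b c * deg v + K a b c * degs a b c)
          ≡⟨ ∑³-+ _ _ ⟨
        ∑ (λ a → ∑ λ b → ∑ λ c → K a b c * Slack v a b c + (K a b c * deg v + K a b c * degs a b c))
          ≡⟨ ∑³-cong (λ a b c → trans (factor (K a b c) (Slack v a b c) (deg v) (degs a b c))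
               (⟦⟧-*-cong (clique₄ v a b c) (∑-slack v a b c))) ⟩
        ∑ (λ a → ∑ λ b → ∑ λ c → K a b c * (+ 2 * + n + + 8))
          ≡⟨ ∑-clique₄-const v _ ⟩
        + 2 * (T₃ v * (+ 2 * + n + + 8)) ∎
        where
        K degs : Fin n → Fin n → Fin n → ℤ
        K a b c = ⟦ clique₄ v a b c ⟧
        degs a b c = deg a + deg b + deg c
        factor : ∀ k s x y → k * s + (k * x + k * y) ≡ k * (s + (x + y))
        factor = solve-∀

      Slack-nonneg : ∀ a b c d → 0ℤ ≤ Slack a b c d
      Slack-nonneg a b c d = ∑-nonneg λ w → slack-nonneg (E a w) (E b w) (E c w) (E d w)

      clique₄-Slack-nonneg : ∀ a b c d → 0ℤ ≤ ⟦ clique₄ a b c d ⟧ * Slack a b c d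
      clique₄-Slack-nonneg a b c d with clique₄ a b c d
      ... | true  = ℤ.≤-trans (Slack-nonneg a b c d) (ℤ.≤-reflexive (sym (ℤ.*-identityˡ _)))
      ... | false = +≤+ ℕ.z≤n

      -- Equality in the edge bound

      module Extremal
        (euler : ∀ v → T₃ v ≡ + 6 * deg v - + 12)
        (h h′ : ℤ) (n≡h+h′ : + n ≡ h + h′) (balanced : h′ ≡ h ⊎ h′ ≡ h + 1ℤ)
        (deg-sum : ∑ deg ≡ + 2 * (h * h′ + + n))
        where

        private
          D S : ℤ
          D = ∑ deg
          S = ∑ λ v → deg v * deg v
          m = h + + 2

        ∑-T₃ : ∑ T₃ ≡ + 6 * D - + 12 * + n
        ∑-T₃ = begin
          ∑ T₃ ≡⟨ ∑-cong euler ⟩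
          ∑ (λ v → + 6 * deg v - + 12) ≡⟨ ∑-+ _ _ ⟩
          ∑ (λ v → + 6 * deg v) + ∑ (λ (v : Fin n) → - + 12) ≡⟨ cong₂ _+_ (sym (∑-*ˡ (+ 6) deg)) (∑-const {n} _) ⟩
          + 6 * D + + n * - + 12 ≡⟨ lemma D (+ n) ⟩
          + 6 * D - + 12 * + n ∎
          where
          lemma : ∀ D n → + 6 * D + n * - + 12 ≡ + 6 * D - + 12 * n
          lemma = solve-∀

        ∑-T₃-deg : ∑ (λ v → T₃ v * deg v) ≡ + 6 * S + - + 12 * D
        ∑-T₃-deg = begin
          ∑ (λ v → T₃ v * deg v) ≡⟨ ∑-cong (λ v → trans (cong (_* deg v) (euler v)) (lemma (deg v))) ⟩
          ∑ (λ v → + 6 * (deg v * deg v) + - + 12 * deg v) ≡⟨ ∑-+ _ _ ⟩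
          ∑ (λ v → + 6 * (deg v * deg v)) + ∑ (λ v → - + 12 * deg v) ≡⟨ cong₂ _+_ (∑-*ˡ (+ 6) λ v → deg v * deg v) (∑-*ˡ (- + 12) deg) ⟨
          + 6 * S + - + 12 * D ∎
          where
          lemma : ∀ d → (+ 6 * d - + 12) * d ≡ + 6 * (d * d) + - + 12 * d
          lemma = solve-∀

        -- By symmetry of `t`, summing over all `v` makes the weights of neighbours equal to those
        -- of `v` itself, so the coefficients 2 and 6 merge into 8.
        ∑-totalSlack : ∑ totalSlack + + 8 * ∑ (λ v → T₃ v * deg v) ≡ + 2 * (∑ T₃ * (+ 2 * + n + + 8))
        ∑-totalSlack = begin
          ∑ totalSlack + + 8 * TD
            ≡⟨ cong (λ x → ∑ totalSlack + x) (split TD) ⟩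
          ∑ totalSlack + (+ 2 * TD + + 6 * TD)
            ≡⟨ cong (λ x → ∑ totalSlack + (+ 2 * TD + + 6 * x))
                 (trans (∑-swap t deg t-sym) (∑-cong λ v → sym (∑-*ʳ (deg v) (t v)))) ⟨
          ∑ totalSlack + (+ 2 * TD + + 6 * ∑ (λ v → ∑ λ a → t v a * deg a))
            ≡⟨ cong (λ x → ∑ totalSlack + x) (cong₂ _+_ (∑-*ˡ (+ 2) λ v → T₃ v * deg v) (∑-*ˡ (+ 6) λ v → ∑ λ a → t v a * deg a)) ⟩
          ∑ totalSlack + (∑ (λ v → + 2 * (T₃ v * deg v)) + ∑ (λ v → + 6 * ∑ λ a → t v a * deg a))
            ≡⟨ cong (λ x → ∑ totalSlack + x) (∑-+ _ _) ⟨
          ∑ totalSlack + ∑ (λ v → + 2 * (T₃ v * deg v) + + 6 * ∑ λ a → t v a * deg a)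
            ≡⟨ ∑-+ _ _ ⟨
          ∑ (λ v → totalSlack v + (+ 2 * (T₃ v * deg v) + + 6 * ∑ λ a → t v a * deg a))
            ≡⟨ ∑-cong totalSlack-eq ⟩
          ∑ (λ v → + 2 * (T₃ v * (+ 2 * + n + + 8)))
            ≡⟨ trans (cong (+ 2 *_) (∑-*ʳ (+ 2 * + n + + 8) T₃)) (∑-*ˡ (+ 2) λ v → T₃ v * (+ 2 * + n + + 8)) ⟨
          + 2 * (∑ T₃ * (+ 2 * + n + + 8)) ∎
          where
          TD = ∑ λ v → T₃ v * deg v
          split : ∀ x → + 8 * x ≡ + 2 * x + + 6 * x
          split = solve-∀

        -- m and m + 1 are the only degrees occurring in J₂(n).
        deviation : Fin n → ℤ
        deviation v = (deg v - m) * (deg v - m - 1ℤ)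

        ∑-deviation : ∑ deviation ≡ S + - (+ 2 * m + 1ℤ) * D + + n * (m * (m + 1ℤ))
        ∑-deviation = begin
          ∑ deviation ≡⟨ ∑-cong (λ v → lemma (deg v) m) ⟩
          ∑ (λ v → deg v * deg v + - (+ 2 * m + 1ℤ) * deg v + m * (m + 1ℤ)) ≡⟨ ∑-+₃ _ _ _ ⟩
          S + ∑ (λ v → - (+ 2 * m + 1ℤ) * deg v) + ∑ (λ (v : Fin n) → m * (m + 1ℤ))
            ≡⟨ cong₂ (λ x y → S + x + y) (sym (∑-*ˡ (- (+ 2 * m + 1ℤ)) deg)) (∑-const {n} _) ⟩
          S + - (+ 2 * m + 1ℤ) * D + + n * (m * (m + 1ℤ)) ∎
          where
          lemma : ∀ d m → (d - m) * (d - m - 1ℤ) ≡ d * d + - (+ 2 * m + 1ℤ) * d + m * (m + 1ℤ)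
          lemma = solve-∀

        -- `∑-T₃-deg` contributes 6 S and enters with factor 8, so 48 copies of the deviation cancel
        -- the sum S of squared degrees. What remains is a polynomial in h, which vanishes because
        -- the degree sum is the extremal one; the parity of n decides which polynomial it is.
        slack+deviation≡0 : ∑ totalSlack + + 48 * ∑ deviation ≡ 0ℤ
        slack+deviation≡0 = begin
          ∑ totalSlack + + 48 * ∑ deviation
            ≡⟨ isolate (∑ totalSlack) (+ 8 * ∑ (λ v → T₃ v * deg v)) (+ 48 * ∑ deviation) ⟩
          ∑ totalSlack + + 8 * ∑ (λ v → T₃ v * deg v) + (+ 48 * ∑ deviation - + 8 * ∑ (λ v → T₃ v * deg v))
            ≡⟨ cong₂ _+_ (trans ∑-totalSlack (cong (λ x → + 2 * (x * (+ 2 * + n + + 8))) ∑-T₃))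
                 (cong₂ (λ x y → + 48 * x - + 8 * y) ∑-deviation ∑-T₃-deg) ⟩
          + 2 * ((+ 6 * D - + 12 * + n) * (+ 2 * + n + + 8))
            + (+ 48 * (S + - (+ 2 * m + 1ℤ) * D + + n * (m * (m + 1ℤ))) - + 8 * (+ 6 * S + - + 12 * D))
            ≡⟨ arithmetic S balanced n≡h+h′ deg-sum ⟩
          0ℤ ∎
          where
          isolate : ∀ x y z → x + z ≡ x + y + (z - y)
          isolate = solve-∀
          even : ∀ S h → let n = h + h; D = + 2 * (h * h + n); m = h + + 2 in
            + 2 * ((+ 6 * D - + 12 * n) * (+ 2 * n + + 8))
            + (+ 48 * (S + - (+ 2 * m + 1ℤ) * D + n * (m * (m + 1ℤ))) - + 8 * (+ 6 * S + - + 12 * D)) ≡ 0ℤ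
          even = solve-∀
          odd : ∀ S h → let n = h + (h + 1ℤ); D = + 2 * (h * (h + 1ℤ) + n); m = h + + 2 in
            + 2 * ((+ 6 * D - + 12 * n) * (+ 2 * n + + 8))
            + (+ 48 * (S + - (+ 2 * m + 1ℤ) * D + n * (m * (m + 1ℤ))) - + 8 * (+ 6 * S + - + 12 * D)) ≡ 0ℤ
          odd = solve-∀
          arithmetic : ∀ {N h′ D} S → h′ ≡ h ⊎ h′ ≡ h + 1ℤ → N ≡ h + h′ → D ≡ + 2 * (h * h′ + N) →
            + 2 * ((+ 6 * D - + 12 * N) * (+ 2 * N + + 8))
            + (+ 48 * (S + - (+ 2 * m + 1ℤ) * D + N * (m * (m + 1ℤ))) - + 8 * (+ 6 * S + - + 12 * D)) ≡ 0ℤ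
          arithmetic S (inj₁ refl) refl refl = even S h
          arithmetic S (inj₂ refl) refl refl = odd S h

        totalSlack-nonneg : ∀ v → 0ℤ ≤ totalSlack v
        totalSlack-nonneg v = ∑-nonneg λ a → ∑-nonneg λ b → ∑-nonneg λ c → clique₄-Slack-nonneg v a b c

        -- A vanishing sum of nonnegative terms vanishes termwise; this is applied once for each of
        -- the four vertices of the facet and once more for `w`.
        slack≡0 : ∀ a b c d → clique₄ a b c d ≡ true → ∀ w → slack (E a w) (E b w) (E c w) (E d w) ≡ 0ℤ
        slack≡0 a b c d K w = ∑-nonneg-≡0 (λ w → slack-nonneg (E a w) (E b w) (E c w) (E d w)) Slack≡0 w
          where
          ∑totalSlack≡0 : ∑ totalSlack ≡ 0ℤ
          ∑totalSlack≡0 = 0≤i+j≡0⇒i≡0 (∑-nonneg totalSlack-nonneg)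
            (ℤ.*-monoˡ-≤-nonNeg (+ 48) (∑-nonneg λ v → pronic-nonneg (deg v - m))) slack+deviation≡0
          K*Slack≡0 : ⟦ clique₄ a b c d ⟧ * Slack a b c d ≡ 0ℤ
          K*Slack≡0 =
            ∑-nonneg-≡0 (λ d → clique₄-Slack-nonneg a b c d)
            (∑-nonneg-≡0 (λ c → ∑-nonneg λ d → clique₄-Slack-nonneg a b c d)
            (∑-nonneg-≡0 (λ b → ∑-nonneg λ c → ∑-nonneg λ d → clique₄-Slack-nonneg a b c d)
            (∑-nonneg-≡0 totalSlack-nonneg ∑totalSlack≡0 a) b) c) d
          Slack≡0 : Slack a b c d ≡ 0ℤ
          Slack≡0 = trans (sym (⟦⟧-*-true _ K)) K*Slack≡0

      -- Codegrees in vertex links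

      module Links
        (euler : ∀ v → T₃ v ≡ + 6 * deg v - + 12)
        (K₅-free : ∀ a b c d → clique₄ a b c d ≡ true → ∀ w → E a w ∧ E b w ∧ E c w ∧ E d w ≡ false)
        (extend₁ : ∀ v → ∃ λ u → E v u ≡ true)
        (extend₂ : ∀ v u → E v u ≡ true → ∃ λ x → E v x ∧ E u x ≡ true)
        (tight : ∀ a b c d → clique₄ a b c d ≡ true → ∀ w → slack (E a w) (E b w) (E c w) (E d w) ≡ 0ℤ)
        where

        extend₃ : ∀ a b c → clique₃ a b c ≡ true → ∃ λ d → clique₄ a b c d ≡ true
        extend₃ a b c abc with count-positive _ (λ eq → contradiction (trans (sym (triangle-two a b c abc)) eq) λ ())
        ... | d , abcd = d , true-∧ abc abcd

        facet : ∀ v u → E v u ≡ true → ∃ λ x → ∃ λ y → clique₄ v u x y ≡ true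
        facet v u vu with extend₂ v u vu
        ... | x , vux with extend₃ v u x (true-∧ vu vux)
        ...   | y , vuxy = x , y , vuxy

        4≤codeg : ∀ v u → E v u ≡ true → + 4 ≤ codeg v u
        4≤codeg v u vu with facet v u vu
        ... | x , y , vuxy = subst (_≤ codeg v u)
          (trans (∑-+ _ _) (cong₂ _+_ (triangle-two v u x vux) (triangle-two v u y (true-∧ vu (true-∧ vy uy)))))
          (∑-mono λ w → two-of-three-≤ (E v w) (E u w) (E x w) (E y w) (K₅-free v u x y vuxy w))
          where
          vux = proj₁ (∧-true {clique₃ v u x} vuxy)
          vy = proj₁ (∧-true {E v y} (proj₂ (∧-true {clique₃ v u x} vuxy)))
          uy = proj₁ (∧-true {E u y} (proj₂ (∧-true {E v y} (proj₂ (∧-true {clique₃ v u x} vuxy)))))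

        codeg+2≤deg : ∀ v u → E v u ≡ true → codeg v u + + 2 ≤ deg v
        codeg+2≤deg v u vu with facet v u vu
        ... | x , y , vuxy = subst (_≤ deg v)
          (trans (∑-+ _ _) (cong (λ k → codeg v u + k) (triangle-two v x y (true-∧ vx (true-∧ vy xy)))))
          (∑-mono λ w → opposite-≤ (E v w) (E u w) (E x w) (E y w) (K₅-free v u x y vuxy w))
          where
          vx = proj₁ (∧-true {E v x} (proj₂ (∧-true {E v u} (proj₁ (∧-true {clique₃ v u x} vuxy)))))
          vy = proj₁ (∧-true {E v y} (proj₂ (∧-true {clique₃ v u x} vuxy)))
          xy = proj₂ (∧-true {E u y} (proj₂ (∧-true {E v y} (proj₂ (∧-true {clique₃ v u x} vuxy)))))

        codeg-sum : ∀ v a b c → clique₄ v a b c ≡ true → codeg v a + codeg v b + codeg v c ≡ deg v + + 6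
        codeg-sum v a b c vabc = begin
          codeg v a + codeg v b + codeg v c
            ≡⟨ ∑-+₃ _ _ _ ⟨
          ∑ (λ w → ⟦ E v w ∧ E a w ⟧ + ⟦ E v w ∧ E b w ⟧ + ⟦ E v w ∧ E c w ⟧)
            ≡⟨ ∑-cong (λ w → slack≡0⇒link-count (E v w) (E a w) (E b w) (E c w)
                 (tight v a b c vabc w) (K₅-free v a b c vabc w)) ⟩
          ∑ (λ w → ⟦ E v w ⟧ + ⟦ E v w ∧ E a w ∧ E b w ⟧ + ⟦ E v w ∧ E a w ∧ E c w ⟧ + ⟦ E v w ∧ E b w ∧ E c w ⟧)
            ≡⟨ ∑-+₄ _ _ _ _ ⟩
          deg v + count (λ w → E v w ∧ E a w ∧ E b w) + count (λ w → E v w ∧ E a w ∧ E c w) + count (λ w → E v w ∧ E b w ∧ E c w)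
            ≡⟨ cong₂ _+_ (cong₂ _+_ (cong (λ k → deg v + k) (triangle-two v a b (proj₁ split)))
                (triangle-two v a c (true-∧ va (true-∧ vc ac)))) (triangle-two v b c (true-∧ vb (true-∧ vc bc))) ⟩
          deg v + + 2 + + 2 + + 2
            ≡⟨ lemma (deg v) ⟩
          deg v + + 6 ∎
          where
          split = ∧-true {clique₃ v a b} vabc
          va = proj₁ (∧-true {E v a} (proj₁ split))
          vb = proj₁ (∧-true {E v b} (proj₂ (∧-true {E v a} (proj₁ split))))
          vc = proj₁ (∧-true {E v c} (proj₂ split))
          ac = proj₁ (∧-true {E a c} (proj₂ (∧-true {E v c} (proj₂ split))))
          bc = proj₂ (∧-true {E a c} (proj₂ (∧-true {E v c} (proj₂ split))))
          lemma : ∀ d → d + + 2 + + 2 + + 2 ≡ d + + 6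
          lemma = solve-∀

        -- By `t≡codeg` the sum on the left is the second moment of the degrees in the link of `v`.
        -- It is computable because tightness makes the link degrees over each triangle of the link
        -- add up to the constant `deg v` + 6.
        ∑-t-codeg : ∀ v → + 6 * ∑ (λ a → t v a * codeg v a) ≡ + 2 * (T₃ v * (deg v + + 6))
        ∑-t-codeg v = begin
          + 6 * ∑ (λ a → t v a * codeg v a)
            ≡⟨ ∑-clique₄-sum v (codeg v) ⟨
          ∑ (λ a → ∑ λ b → ∑ λ c → ⟦ clique₄ v a b c ⟧ * (codeg v a + codeg v b + codeg v c))
            ≡⟨ ∑³-cong (λ a b c → ⟦⟧-*-cong (clique₄ v a b c) (codeg-sum v a b c)) ⟩
          ∑ (λ a → ∑ λ b → ∑ λ c → ⟦ clique₄ v a b c ⟧ * (deg v + + 6))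
            ≡⟨ ∑-clique₄-const v _ ⟩
          + 2 * (T₃ v * (deg v + + 6)) ∎

        gap : Fin n → Fin n → ℤ
        gap v u = ⟦ E v u ⟧ * ((codeg v u - + 4) * (deg v - (codeg v u + + 2)))

        gap-nonneg : ∀ v u → 0ℤ ≤ gap v u
        gap-nonneg v u = subst (_≤ gap v u) (ℤ.*-zeroʳ ⟦ E v u ⟧)
          (⟦⟧-*-mono (E v u) λ vu → *-nonneg (ℤ.i≤j⇒0≤j-i (4≤codeg v u vu)) (ℤ.i≤j⇒0≤j-i (codeg+2≤deg v u vu)))

        -- With d = `deg v` and link degrees ℓ, expanding gives -Σℓ² + (d + 2)Σℓ - 4(d - 2)d. Here
        -- Σℓ = 6d - 12 is the Euler relation and Σℓ² = (2d - 4)(d + 6) is `∑-t-codeg`, and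
        -- everything cancels. The factor 6 is carried along to avoid dividing the second moment.
        ∑-gap : ∀ v → ∑ (gap v) ≡ 0ℤ
        ∑-gap v = ℤ.*-cancelˡ-≡ (+ 6) _ _ (begin
          + 6 * ∑ (gap v)
            ≡⟨ cong (+ 6 *_) (∑-cong λ u → trans (expand ⟦ E v u ⟧ (codeg v u) g)
                 (cong (λ x → - 1ℤ * (x * codeg v u) + (g + + 2) * x + - (+ 4 * (g - + 2)) * ⟦ E v u ⟧) (sym (t≡codeg v u)))) ⟩
          + 6 * ∑ (λ u → - 1ℤ * (t v u * codeg v u) + (g + + 2) * t v u + - (+ 4 * (g - + 2)) * ⟦ E v u ⟧)
            ≡⟨ cong (+ 6 *_) (trans (∑-+₃ _ _ _) (cong₂ _+_ (cong₂ _+_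
                 (sym (∑-*ˡ (- 1ℤ) λ u → t v u * codeg v u))
                 (sym (∑-*ˡ (g + + 2) (t v))))
                 (sym (∑-*ˡ (- (+ 4 * (g - + 2))) λ u → ⟦ E v u ⟧)))) ⟩
          + 6 * (- 1ℤ * S + (g + + 2) * T₃ v + - (+ 4 * (g - + 2)) * g)
            ≡⟨ distribute S (T₃ v) g ⟩
          - 1ℤ * (+ 6 * S) + + 6 * ((g + + 2) * T₃ v + - (+ 4 * (g - + 2)) * g)
            ≡⟨ cong₂ (λ x y → - 1ℤ * x + + 6 * ((g + + 2) * y + - (+ 4 * (g - + 2)) * g))
                 (trans (∑-t-codeg v) (cong (λ y → + 2 * (y * (g + + 6))) (euler v))) (euler v) ⟩
          - 1ℤ * (+ 2 * ((+ 6 * g - + 12) * (g + + 6))) + + 6 * ((g + + 2) * (+ 6 * g - + 12) + - (+ 4 * (g - + 2)) * g)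
            ≡⟨ cancel g ⟩
          + 6 * 0ℤ ∎)
          where
          g = deg v
          S = ∑ λ u → t v u * codeg v u
          expand : ∀ e l g → e * ((l - + 4) * (g - (l + + 2))) ≡
            - 1ℤ * (e * l * l) + (g + + 2) * (e * l) + - (+ 4 * (g - + 2)) * e
          expand = solve-∀
          distribute : ∀ S T g → + 6 * (- 1ℤ * S + (g + + 2) * T + - (+ 4 * (g - + 2)) * g) ≡
            - 1ℤ * (+ 6 * S) + + 6 * ((g + + 2) * T + - (+ 4 * (g - + 2)) * g)
          distribute = solve-∀
          cancel : ∀ g → - 1ℤ * (+ 2 * ((+ 6 * g - + 12) * (g + + 6))) + + 6 * ((g + + 2) * (+ 6 * g - + 12) + - (+ 4 * (g - + 2)) * g) ≡ + 6 * 0ℤ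
          cancel = solve-∀

        codeg-dichotomy : ∀ v u → E v u ≡ true → codeg v u ≡ + 4 ⊎ codeg v u + + 2 ≡ deg v
        codeg-dichotomy v u vu = Sum.map (ℤ.i-j≡0⇒i≡j (codeg v u) (+ 4)) (sym ∘ ℤ.i-j≡0⇒i≡j (deg v) (codeg v u + + 2))
          (ℤ.i*j≡0⇒i≡0∨j≡0 (codeg v u - + 4) (trans (sym (⟦⟧-*-true _ vu)) (∑-nonneg-≡0 (gap-nonneg v) (∑-gap v) u)))

        -- If every edge at v had codegree 4, then 4 deg v = 6 deg v - 12, so deg v - 2 = 4 as well.
        pole : ∀ v → ∃ λ u → E v u ≡ true × codeg v u + + 2 ≡ deg v
        pole v with any (λ u → E v u ∧ does (codeg v u + + 2 ℤ.≟ deg v))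
        ... | inj₁ (u , eq) = u , proj₁ (∧-true {E v u} eq) ,
          does-true (codeg v u + + 2 ℤ.≟ deg v) (proj₂ (∧-true {E v u} eq))
        pole v | inj₂ none with extend₁ v
        ... | u , vu = u , vu , trans (cong (_+ + 2) (all-4 u vu)) (sym deg≡6)
          where
          all-4 : ∀ u → E v u ≡ true → codeg v u ≡ + 4
          all-4 u vu = [ (λ eq → eq) , (λ eq → contradiction
            (trans (sym (true-∧ vu (dec-true (codeg v u + + 2 ℤ.≟ deg v) eq))) (none u)) λ ()) ]′ (codeg-dichotomy v u vu)
          T₃≡4deg : T₃ v ≡ deg v * + 4
          T₃≡4deg = trans (∑-cong λ u → trans (t≡codeg v u) (⟦⟧-*-cong (E v u) (all-4 u))) (sym (∑-*ʳ (+ 4) _))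
          deg≡6 : deg v ≡ + 6
          deg≡6 = ℤ.*-cancelˡ-≡ (+ 2) _ _ (begin
            + 2 * deg v                                   ≡⟨ lemma (deg v) ⟩
            + 6 * deg v - + 12 - deg v * + 4 + + 12       ≡⟨ cong (λ x → x - deg v * + 4 + + 12) (trans (sym (euler v)) T₃≡4deg) ⟩
            deg v * + 4 - deg v * + 4 + + 12              ≡⟨ cong (_+ + 12) (ℤ.+-inverseʳ (deg v * + 4)) ⟩
            + 12                                          ∎)
            where
            lemma : ∀ d → + 2 * d ≡ + 6 * d - + 12 - d * + 4 + + 12
            lemma = solve-∀

        codeg-sym : ∀ u v → codeg u v ≡ codeg v u
        codeg-sym u v = ∑-cong λ w → cong ⟦_⟧ (Bool.∧-comm (E u w) (E v w))

        mutual-poles : Fin n → ∃ λ v → ∃ λ u → E v u ≡ true × codeg v u + + 2 ≡ deg v × codeg u v + + 2 ≡ deg u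
        mutual-poles v₀ with argmax deg v₀
        ... | v , max with pole v
        -- Maximality gives `deg u` ≤ `deg v`, which is the codegree plus 2, and the codegree is
        -- symmetric in `u` and `v`.
        ...   | u , vu , eq = v , u , vu , eq , ℤ.≤-antisym (codeg+2≤deg u v (trans (E-sym u v) vu))
          (ℤ.≤-trans (max u) (ℤ.≤-reflexive (trans (sym eq) (cong (_+ + 2) (codeg-sym v u)))))

        -- The two sides of the join

        module Join (v u : Fin n) (vu : E v u ≡ true)
          (v-pole : codeg v u + + 2 ≡ deg v) (u-pole : codeg u v + + 2 ≡ deg u) where

          B A : Fin n → Bool
          B w = E v w ∧ E u w
          A w = not (B w)

          fourth : ∀ c → B c ≡ true → ∃ λ d → clique₄ v u c d ≡ true
          fourth c Bc = extend₃ v u c (true-∧ vu Bc)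

          -- Besides the common neighbours, v has just two neighbours, and two vertices complete vcd.
          one-sided : ∀ v u → codeg v u + + 2 ≡ deg v → ∀ c d → clique₄ v u c d ≡ true →
            ∀ w → E v w ≡ true → E u w ≡ false → E c w ≡ true
          one-sided v u v-pole c d vucd w vw uw = proj₁ (∧-true {E c w} (⟦⟧≡1⇒true (trans
            (subst₂ (λ p q → ⟦ E c w ∧ E d w ⟧ ≡ ⟦ p ∧ not q ⟧) vw uw
              (subst (λ p → ⟦ p ∧ E c w ∧ E d w ⟧ ≡ ⟦ E v w ∧ not (E u w) ⟧) vw agree)) refl)))
            where
            split = ∧-true {clique₃ v u c} vucd
            vc = proj₁ (∧-true {E v c} (proj₂ (∧-true {E v u} (proj₁ split))))
            vd = proj₁ (∧-true {E v d} (proj₂ split))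
            cd = proj₂ (∧-true {E u d} (proj₂ (∧-true {E v d} (proj₂ split))))
            others : count (λ w → E v w ∧ not (E u w)) ≡ + 2
            others = begin
              others# ≡⟨ lemma (codeg v u) others# ⟩
              codeg v u + others# - codeg v u ≡⟨ cong (_- codeg v u) (count-split (E v) (E u)) ⟨
              deg v - codeg v u ≡⟨ cong (_- codeg v u) (sym v-pole) ⟩
              codeg v u + + 2 - codeg v u ≡⟨ lemma (codeg v u) (+ 2) ⟨
              + 2 ∎
              where
              others# = count λ w → E v w ∧ not (E u w)
              lemma : ∀ x y → y ≡ x + y - x
              lemma = solve-∀
            -- Without 5-cliques no completion of `v`, `c`, `d` is adjacent to `u`. The completions
            -- thus lie among the neighbours of `v` outside those of `u`; both sets have two
            -- elements, so they coincide.
            agree : ⟦ E v w ∧ E c w ∧ E d w ⟧ ≡ ⟦ E v w ∧ not (E u w) ⟧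
            agree = ∑-mono-≡ (λ w → two-of-three-≤-not (E v w) (E u w) (E c w) (E d w) (K₅-free v u c d vucd w))
              (trans (triangle-two v c d (true-∧ vc (true-∧ vd cd))) (sym others)) w

          clique₄-flip : ∀ c d → clique₄ v u c d ≡ true → clique₄ u v c d ≡ true
          clique₄-flip c d K = trans (sym flip) K
            where
            open ∨-∧-Solver using (_:*_; _:=_)
            flip : clique₄ v u c d ≡ clique₄ u v c d
            flip rewrite E-sym u v = ∨-∧-Solver.solve 6 (λ vu vc uc vd ud cd →
              (vu :* (vc :* uc)) :* (vd :* (ud :* cd)) := (vu :* (uc :* vc)) :* (ud :* (vd :* cd)))
              refl (E v u) (E v c) (E u c) (E v d) (E u d) (E c d)

          -- A vertex of `A` misses at least one pole. If it sees exactly one, `one-sided` applies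
          -- at that pole; if it sees neither, zero slack at the facet through `c` demands adjacency
          -- to both remaining vertices of the facet.
          join : ∀ w c → A w ≡ true → B c ≡ true → E c w ≡ true
          join w c Aw Bc with fourth c Bc
          ... | d , vucd with E v w in vw | E u w in uw
          ...   | true  | true  = contradiction Aw λ ()
          ...   | true  | false = one-sided v u v-pole c d vucd w vw uw
          ...   | false | true  = one-sided u v u-pole c d (clique₄-flip c d vucd) w uw vw
          ...   | false | false = slack≡0⇒both (E c w) (E d w)
            (subst₂ (λ p q → slack p q (E c w) (E d w) ≡ 0ℤ) vw uw (tight v u c d vucd w))

          B-regular : ∀ c → B c ≡ true → count (λ w → B w ∧ E c w) ≡ + 2
          B-regular c Bc = trans (∑-cong λ w → cong ⟦_⟧ (Bool.∧-assoc (E v w) (E u w) (E c w)))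
            (triangle-two v u c (true-∧ vu Bc))

          edge-in-B : ∃ λ c → ∃ λ d → clique₄ v u c d ≡ true
          edge-in-B = facet v u vu

          private
            c = proj₁ edge-in-B
            d = proj₁ (proj₂ edge-in-B)
            vucd = proj₂ (proj₂ edge-in-B)
            split = ∧-true {clique₃ v u c} vucd
            Bc : B c ≡ true
            Bc = proj₂ (∧-true {E v u} (proj₁ split))
            vd = proj₁ (∧-true {E v d} (proj₂ split))
            ud = proj₁ (∧-true {E u d} (proj₂ (∧-true {E v d} (proj₂ split))))
            cd = proj₂ (∧-true {E u d} (proj₂ (∧-true {E v d} (proj₂ split))))
            Bd : B d ≡ true
            Bd = true-∧ vd ud

          clique₃-cd : ∀ a → A a ≡ true → clique₃ c d a ≡ true
          clique₃-cd a Aa = true-∧ cd (true-∧ (join a c Aa Bc) (join a d Aa Bd))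

          -- The neighbours of `a` inside `A` are the two completions of the triangle `c`, `d`, `a`:
          -- every vertex of `A` is adjacent to `c` and `d` by `join`, and a vertex of `B` adjacent
          -- to both would form a 5-clique with `v`, `u`, `c`, `d`.
          A-regular : ∀ a → A a ≡ true → count (λ w → A w ∧ E a w) ≡ + 2
          A-regular a Aa = trans (∑-cong λ w → cong ⟦_⟧ (pointwise w)) (triangle-two c d a (clique₃-cd a Aa))
            where
            pointwise : ∀ w → A w ∧ E a w ≡ E c w ∧ E d w ∧ E a w
            pointwise w with B w in Bw
            ... | false rewrite join w c (cong not Bw) Bc | join w d (cong not Bw) Bd = refl
            ... | true with ∧-true {E v w} Bw
            ...   | vw , uw = sym (trans (sym (Bool.∧-assoc (E c w) (E d w) (E a w))) (cong (_∧ E a w)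
              (subst₂ (λ p q → p ∧ q ∧ E c w ∧ E d w ≡ false) vw uw (K₅-free v u c d vucd w))))

          B-triangle-free : ∀ x y z → B x ≡ true → B y ≡ true → B z ≡ true → clique₃ x y z ≡ false
          B-triangle-free x y z Bx By Bz = Bool.¬-not λ xyz → contradiction
            (trans (sym (K₅-free v u x y (true-∧ (true-∧ vu Bx) (true-∧ (proj₁ (∧-true {E v y} By))
              (true-∧ (proj₂ (∧-true {E v y} By)) (proj₁ (∧-true {E x y} xyz))))) z))
              (true-∧ (proj₁ (∧-true {E v z} Bz)) (true-∧ (proj₂ (∧-true {E v z} Bz)) (proj₂ (∧-true {E x y} xyz))))) λ ()

          -- The edge `c`, `d` inside `B` now plays the part that the edge `v`, `u` plays for `B`:
          -- with a triangle on the other side it would form a 5-clique.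
          A-triangle-free : ∀ x y z → A x ≡ true → A y ≡ true → A z ≡ true → clique₃ x y z ≡ false
          A-triangle-free x y z Ax Ay Az = Bool.¬-not λ xyz → contradiction
            (trans (sym (K₅-free c d x y (true-∧ (clique₃-cd x Ax) (true-∧ (join y c Ay Bc)
              (true-∧ (join y d Ay Bd) (proj₁ (∧-true {E x y} xyz))))) z))
              (true-∧ (join z c Az Bc) (true-∧ (join z d Az Bd) (proj₂ (∧-true {E x y} xyz))))) λ ()

          private
            α β : ℤ
            α = count A
            β = count B

          α+β≡n : α + β ≡ + n
          α+β≡n = trans (ℤ.+-comm α β) (trans (sym (count-split (λ _ → true) B)) (trans (∑-const {n} 1ℤ) (ℤ.*-identityʳ (+ n))))

          deg-split : ∀ x → deg x ≡ + 2 + ⟦ B x ⟧ * α + ⟦ A x ⟧ * β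
          deg-split x with B x in Bx
          ... | true = begin
            deg x ≡⟨ count-split (E x) B ⟩
            count (λ w → E x w ∧ B w) + count (λ w → E x w ∧ A w)
              ≡⟨ cong₂ _+_ (trans (∑-cong λ w → cong ⟦_⟧ (Bool.∧-comm (E x w) (B w))) (B-regular x Bx))
                   (∑-cong λ w → cong ⟦_⟧ (∧-implied (E x w) (A w) λ Aw → join w x Aw Bx)) ⟩
            + 2 + α ≡⟨ lemma α β ⟩
            + 2 + 1ℤ * α + 0ℤ * β ∎
            where
            lemma : ∀ a b → + 2 + a ≡ + 2 + 1ℤ * a + 0ℤ * b
            lemma = solve-∀
          ... | false = begin
            deg x ≡⟨ count-split (E x) B ⟩
            count (λ w → E x w ∧ B w) + count (λ w → E x w ∧ A w)
              ≡⟨ cong₂ _+_ (∑-cong λ w → cong ⟦_⟧ (∧-implied (E x w) (B w) λ Bw → trans (E-sym x w) (join x w (cong not Bx) Bw)))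
                   (trans (∑-cong λ w → cong ⟦_⟧ (Bool.∧-comm (E x w) (A w))) (A-regular x (cong not Bx))) ⟩
            β + + 2 ≡⟨ lemma α β ⟩
            + 2 + 0ℤ * α + 1ℤ * β ∎
            where
            lemma : ∀ a b → b + + 2 ≡ + 2 + 0ℤ * a + 1ℤ * b
            lemma = solve-∀

          ∑-deg : ∑ deg ≡ + 2 * (α * β + + n)
          ∑-deg = begin
            ∑ deg ≡⟨ trans (∑-cong deg-split) (∑-+₃ _ _ _) ⟩
            ∑ (λ (x : Fin n) → + 2) + ∑ (λ x → ⟦ B x ⟧ * α) + ∑ (λ x → ⟦ A x ⟧ * β)
              ≡⟨ cong₂ _+_ (cong₂ _+_ (∑-const {n} (+ 2)) (sym (∑-*ʳ α _))) (sym (∑-*ʳ β _)) ⟩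
            + n * + 2 + β * α + α * β ≡⟨ lemma (+ n) α β ⟩
            + 2 * (α * β + + n) ∎
            where
            lemma : ∀ n a b → n * + 2 + b * a + a * b ≡ + 2 * (a * b + n)
            lemma = solve-∀

          -- `∑-deg` evaluates the degree sum of the join, so the two pairs have the same sum and
          -- the same product, and are the roots of one quadratic.
          sizes : ∀ h h′ → + n ≡ h + h′ → ∑ deg ≡ + 2 * (h * h′ + + n) → (α ≡ h × β ≡ h′) ⊎ (α ≡ h′ × β ≡ h)
          sizes h h′ n≡ deg-sum = roots h h′ (trans α+β≡n n≡) αβ≡hh′
            where
            αβ≡hh′ : α * β ≡ h * h′
            αβ≡hh′ = +-cancelʳ (+ n) _ _ (ℤ.*-cancelˡ-≡ (+ 2) _ _ (trans (sym ∑-deg) deg-sum))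
            roots : ∀ {a b} h h′ → a + b ≡ h + h′ → a * b ≡ h * h′ → (a ≡ h × b ≡ h′) ⊎ (a ≡ h′ × b ≡ h)
            roots {a} {b} h h′ sum prod = Sum.map
              (λ eq → let a≡h = ℤ.i-j≡0⇒i≡j a h eq in
                a≡h , +-cancelˡ a b h′ (trans sum (cong (_+ h′) (sym a≡h))))
              (λ eq → let a≡h′ = ℤ.i-j≡0⇒i≡j a h′ eq in
                a≡h′ , +-cancelˡ a b h (trans sum (trans (ℤ.+-comm h h′) (cong (_+ h) (sym a≡h′)))))
              (ℤ.i*j≡0⇒i≡0∨j≡0 (a - h) factored)
              where
              factored : (a - h) * (a - h′) ≡ 0ℤ
              factored = begin
                (a - h) * (a - h′)              ≡⟨ lemma₁ a h h′ ⟩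
                a * a - a * (h + h′) + h * h′   ≡⟨ cong₂ (λ x y → a * a - a * x + y) sum prod ⟨
                a * a - a * (a + b) + a * b     ≡⟨ lemma₂ a b ⟩
                0ℤ ∎
                where
                lemma₁ : ∀ a h k → (a - h) * (a - k) ≡ a * a - a * (h + k) + h * k
                lemma₁ = solve-∀
                lemma₂ : ∀ a b → a * a - a * (a + b) + a * b ≡ 0ℤ
                lemma₂ = solve-∀

open FacetCounting

-- Cutting a triangle-free 2-regular graph into cycles

module CycleDecompositions where

  open import Data.Integer using (ℤ; +_; 0ℤ; 1ℤ; _+_; _*_; _-_; -_; _≤_; +≤+; -[1+_])

  next-wrap : ∀ k → next (suc k) k ≡ 0
  next-wrap k with k ℕ.≡ᵇ k | ℕ.≡⇒≡ᵇ k k refl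
  ... | true | _ = refl

  next-suc : ∀ {k i} → suc i ≢ k → next k i ≡ suc i
  next-suc {k} {i} i+1≢k with suc i ℕ.≡ᵇ k in eq
  ... | true  = contradiction (ℕ.≡ᵇ⇒≡ (suc i) k (subst T (sym eq) _)) i+1≢k
  ... | false = refl

  next-cases : ∀ {k} i → i ℕ.< k → (suc i ≡ k × next k i ≡ 0) ⊎ (suc i ℕ.< k × next k i ≡ suc i)
  next-cases {k} i i<k with suc i ℕ.≟ k
  ... | yes refl  = inj₁ (refl , next-wrap i)
  ... | no  i+1≢k = inj₂ (ℕ.≤∧≢⇒< i<k i+1≢k , next-suc i+1≢k)

  module Cycles {n : ℕ} (E : Fin n → Fin n → Bool)
    (E-sym : ∀ a b → E a b ≡ E b a) (E-irrefl : ∀ a → E a a ≡ false) where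

    record TwoRegular (R : Fin n → Bool) : Set where
      field
        regular       : ∀ x → R x ≡ true → count (λ w → R w ∧ E x w) ≡ + 2
        triangle-free : ∀ x y z → R x ≡ true → R y ≡ true → R z ≡ true → E x y ∧ E x z ∧ E y z ≡ false

    record CycleDecomposition (R : Fin n → Bool) : Set where
      field
        lengths    : List ℕ
        lengths≥4  : All (4 ℕ.≤_) lengths
        sum≡count  : + sum lengths ≡ count R
        φ          : CycV lengths → Fin n
        φ∈R        : ∀ c → R (φ c) ≡ true
        surjective : ∀ x → R x ≡ true → ∃ λ c → φ c ≡ x
        injective  : ∀ c d → φ c ≡ φ d → c ≡ d
        adj⇒       : ∀ c d → E (φ c) (φ d) ≡ true → Adj lengths c d
        adj⇐       : ∀ c d → Adj lengths c d → E (φ c) (φ d) ≡ true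

    E-≢ : ∀ {a b} → E a b ≡ true → a ≢ b
    E-≢ {a} ab refl = contradiction (trans (sym ab) (E-irrefl a)) λ ()

    E-sym-true : ∀ {a b} → E a b ≡ true → E b a ≡ true
    E-sym-true {a} {b} ab = trans (E-sym b a) ab

    module Walk (R : Fin n → Bool) (R-two : TwoRegular R) (r : Fin n) (Rr : R r ≡ true) where
      open TwoRegular R-two

      -- The next vertex of a walk that never turns back depends on where it came from, so the state
      -- of the walk is a directed edge.
      record Dart : Set where
        field
          src tgt : Fin n
          src∈R   : R src ≡ true
          tgt∈R   : R tgt ≡ true
          edge    : E src tgt ≡ true
      open Dart

      other : ∀ x y → R x ≡ true → R y ≡ true → E x y ≡ true →
        ∃ λ z → R z ∧ E y z ≡ true × z ≢ x × (∀ w → R w ∧ E y w ≡ true → w ≡ x ⊎ w ≡ z)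
      other x y Rx Ry xy = count≡2 (λ w → R w ∧ E y w) (regular y Ry) x (true-∧ Rx (E-sym-true xy))

      otherᵈ : ∀ d → ∃ λ z → R z ∧ E (d .tgt) z ≡ true × z ≢ d .src × (∀ w → R w ∧ E (d .tgt) w ≡ true → w ≡ d .src ⊎ w ≡ z)
      otherᵈ d = other (d .src) (d .tgt) (d .src∈R) (d .tgt∈R) (d .edge)

      step : Dart → Dart
      step d .src   = d .tgt
      step d .tgt   = proj₁ (otherᵈ d)
      step d .src∈R = d .tgt∈R
      step d .tgt∈R = proj₁ (∧-true (proj₁ (proj₂ (otherᵈ d))))
      step d .edge  = proj₂ (∧-true {R (proj₁ (otherᵈ d))} (proj₁ (proj₂ (otherᵈ d))))

      start : Dart
      start with count-positive _ (λ eq → contradiction (trans (sym (regular r Rr)) eq) λ ())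
      ... | s , Rs∧rs = record { src = r ; tgt = s ; src∈R = Rr
        ; tgt∈R = proj₁ (∧-true Rs∧rs) ; edge = proj₂ (∧-true {R s} Rs∧rs) }

      dart : ℕ → Dart
      dart zero    = start
      dart (suc i) = step (dart i)

      w : ℕ → Fin n
      w i = dart i .src

      w∈R : ∀ i → R (w i) ≡ true
      w∈R i = dart i .src∈R

      w-edge : ∀ i → E (w i) (w (suc i)) ≡ true
      w-edge i = dart i .edge

      w-nonbacktracking : ∀ i → w (suc (suc i)) ≢ w i
      w-nonbacktracking i = proj₁ (proj₂ (proj₂ (otherᵈ (dart i))))

      w-neighbours : ∀ i z → R z ≡ true → E (w (suc i)) z ≡ true → z ≡ w i ⊎ z ≡ w (suc (suc i))
      w-neighbours i z Rz e = proj₂ (proj₂ (proj₂ (otherᵈ (dart i)))) z (true-∧ Rz e)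

      InjectiveBelow : ℕ → Set
      InjectiveBelow k = ∀ i j → i ℕ.< k → j ℕ.< k → w i ≡ w j → i ≡ j

      -- The first repetition can only be at the starting point: an inner vertex of the walk already
      -- has both its neighbours on the walk, so the predecessor of a vertex returning there would
      -- be one of them, against injectivity or the ban on turning back.
      fresh : ∀ k → InjectiveBelow k → w k ≢ w 0 → ∀ i → i ℕ.< k → w k ≢ w i
      fresh k       inj ≢w0 zero    _   = ≢w0
      fresh (suc k) inj ≢w0 (suc i) i<k eq
        with w-neighbours i (w k) (w∈R k) (subst (λ x → E x (w k) ≡ true) eq (E-sym-true (w-edge k)))
      ... | inj₁ wk≡wi with inj k i ℕ.≤-refl (ℕ.<-trans (ℕ.n<1+n i) i<k) wk≡wi
      ...   | refl = contradiction i<k (ℕ.<-irrefl refl)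
      fresh (suc k) inj ≢w0 (suc i) i<k eq | inj₂ wk≡ with suc i ℕ.≟ k
      ... | yes refl = contradiction wk≡ (E-≢ (w-edge k))
      ... | no  i≢k with inj k (suc (suc i)) ℕ.≤-refl (ℕ.s≤s (ℕ.≤∧≢⇒< (ℕ.≤-pred i<k) i≢k)) wk≡
      ...   | refl = w-nonbacktracking (suc i) eq

      extend-injective : ∀ k → InjectiveBelow k → w k ≢ w 0 → InjectiveBelow (suc k)
      extend-injective k inj ≢w0 i j i≤k j≤k eq with ℕ.m≤n⇒m<n∨m≡n (ℕ.≤-pred i≤k) | ℕ.m≤n⇒m<n∨m≡n (ℕ.≤-pred j≤k)
      ... | inj₁ i<k  | inj₁ j<k  = inj i j i<k j<k eq
      ... | inj₁ i<k  | inj₂ refl = contradiction (sym eq) (fresh k inj ≢w0 i i<k)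
      ... | inj₂ refl | inj₁ j<k  = contradiction eq (fresh k inj ≢w0 j j<k)
      ... | inj₂ refl | inj₂ refl = refl

      injective-below-1 : InjectiveBelow 1
      injective-below-1 zero zero _ _ _ = refl
      injective-below-1 (suc _) _ (ℕ.s≤s ()) _ _
      injective-below-1 zero (suc _) _ (ℕ.s≤s ()) _

      injective-below-3 : InjectiveBelow 3
      injective-below-3 = extend-injective 2
        (extend-injective 1 injective-below-1 λ eq → E-≢ (w-edge 0) (sym eq)) (w-nonbacktracking 0)

      injective⇒≤n : ∀ k → InjectiveBelow k → k ℕ.≤ n
      injective⇒≤n k inj = Fin.injective⇒≤ {f = λ i → w (toℕ {k} i)} λ {i} {j} eq →
        Fin.toℕ-injective (inj _ _ (Fin.toℕ<n i) (Fin.toℕ<n j) eq)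

      -- When the fuel is spent, more than n distinct vertices have been visited, which is
      -- impossible. The search begins at 3 because the first three vertices are always distinct.
      first-return : ∀ fuel k → 3 ℕ.≤ k → n ℕ.< k ℕ.+ fuel → InjectiveBelow k →
        ∃ λ k → 3 ℕ.≤ k × InjectiveBelow k × w k ≡ w 0
      first-return zero k 3≤k n<k inj =
        contradiction (ℕ.<-≤-trans (subst (n ℕ.<_) (ℕ.+-identityʳ k) n<k) (injective⇒≤n k inj)) (ℕ.<-irrefl refl)
      first-return (suc fuel) k 3≤k n<k inj with w k Fin.≟ w 0
      ... | yes closed = k , 3≤k , inj , closed
      ... | no  open′  = first-return fuel (suc k) (ℕ.m≤n⇒m≤1+n 3≤k) (subst (n ℕ.<_) (ℕ.+-suc k fuel) n<k)
                           (extend-injective k inj open′)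

      returns : ∃ λ k → 3 ℕ.≤ k × InjectiveBelow k × w k ≡ w 0
      returns = first-return n 3 ℕ.≤-refl (ℕ.m<n+m n (ℕ.s≤s ℕ.z≤n)) injective-below-3

      k : ℕ
      k = proj₁ returns
      3≤k = proj₁ (proj₂ returns)
      injective = proj₁ (proj₂ (proj₂ returns))
      closed = proj₂ (proj₂ (proj₂ returns))

      4≤k : 4 ℕ.≤ k
      4≤k = ℕ.≤∧≢⇒< 3≤k λ 3≡k → contradiction
        (trans (sym (true-∧ (w-edge 0) (true-∧ (E-sym-true (subst (λ x → E (w 2) x ≡ true)
            (trans (cong w 3≡k) closed) (w-edge 2))) (w-edge 1))))
          (triangle-free (w 0) (w 1) (w 2) (w∈R 0) (w∈R 1) (w∈R 2))) λ ()

      next<k : ∀ i → i ℕ.< k → next k i ℕ.< k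
      next<k i i<k with next-cases i i<k
      ... | inj₁ (_ , eq)     = subst (ℕ._< k) (sym eq) (ℕ.≤-trans (ℕ.s≤s ℕ.z≤n) 4≤k)
      ... | inj₂ (i+1<k , eq) = subst (ℕ._< k) (sym eq) i+1<k

      w-next : ∀ i → i ℕ.< k → w (suc i) ≡ w (next k i)
      w-next i i<k with next-cases i i<k
      ... | inj₁ (i+1≡k , eq) = trans (cong w i+1≡k) (trans closed (cong w (sym eq)))
      ... | inj₂ (_ , eq)     = cong w (sym eq)

      pred-k : ∃ λ k′ → suc k′ ≡ k
      pred-k with k | 4≤k
      ... | suc k′ | _ = k′ , refl

      cycle-neighbours : ∀ i → i ℕ.< k → ∀ z → R z ≡ true → E (w i) z ≡ true →
        z ≡ w (next k i) ⊎ ∃ λ j → j ℕ.< k × next k j ≡ i × z ≡ w j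
      cycle-neighbours (suc i) i<k z Rz e with w-neighbours i z Rz e
      ... | inj₁ eq = inj₂ (i , ℕ.<-trans (ℕ.n<1+n i) i<k , next-suc (ℕ.<⇒≢ i<k) , eq)
      ... | inj₂ eq = inj₁ (trans eq (w-next (suc i) i<k))
      -- The starting vertex has no predecessor in the walk, so its neighbours are read off at time
      -- `k`, when the walk is back there.
      cycle-neighbours zero 0<k z Rz e with pred-k
      ... | k′ , k≡ with w-neighbours k′ z Rz (subst (λ x → E x z ≡ true) (trans (sym closed) (cong w (sym k≡))) e)
      ...   | inj₁ eq = inj₂ (k′ , ℕ.≤-reflexive k≡ , trans (cong (λ k → next k k′) (sym k≡)) (next-wrap k′) , eq)
      ...   | inj₂ eq = inj₁ (trans eq (trans (sym w1≡) (w-next 0 0<k)))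
        where
        -- After closing up, the walk goes round in the same direction: had it come back through
        -- `w 1`, then k would be 2.
        w1≡ : w 1 ≡ w (suc (suc k′))
        w1≡ with w-neighbours k′ (w 1) (w∈R 1) (subst (λ x → E x (w 1) ≡ true) (trans (sym closed) (cong w (sym k≡))) (w-edge 0))
        ... | inj₂ eq = eq
        ... | inj₁ eq with injective 1 k′ (ℕ.≤-trans (ℕ.s≤s (ℕ.s≤s ℕ.z≤n)) 4≤k) (ℕ.≤-reflexive k≡) eq
        ...   | refl = contradiction 4≤k (subst (λ k → ¬ 4 ℕ.≤ k) k≡ λ { (ℕ.s≤s (ℕ.s≤s ())) })

      cyc⇒ : ∀ i j → i ℕ.< k → j ℕ.< k → E (w i) (w j) ≡ true → CycAdj k i j
      cyc⇒ i j i<k j<k e with cycle-neighbours i i<k (w j) (w∈R j) e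
      ... | inj₁ eq = inj₁ (injective _ _ (next<k i i<k) j<k (sym eq))
      ... | inj₂ (j′ , j′<k , next≡ , eq) = inj₂ (trans (cong (next k) (injective _ _ j<k j′<k eq)) next≡)

      next-edge : ∀ i → i ℕ.< k → E (w i) (w (next k i)) ≡ true
      next-edge i i<k = subst (λ x → E (w i) x ≡ true) (w-next i i<k) (w-edge i)

      cyc⇐ : ∀ i j → i ℕ.< k → j ℕ.< k → CycAdj k i j → E (w i) (w j) ≡ true
      cyc⇐ i j i<k j<k (inj₁ refl) = next-edge i i<k
      cyc⇐ i j i<k j<k (inj₂ refl) = E-sym-true (next-edge j j<k)

      c : Fin k → Fin n
      c = w ∘ toℕ

      c-injective : ∀ i j → c i ≡ c j → i ≡ j
      c-injective i j eq = Fin.toℕ-injective (injective _ _ (Fin.toℕ<n i) (Fin.toℕ<n j) eq)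

      on-cycle? : ∀ x → Dec (∃ λ i → x ≡ c i)
      on-cycle? x = Fin.any? λ i → x Fin.≟ c i

      c-from-ℕ : ∀ {j x} → j ℕ.< k → x ≡ w j → ∃ λ i → x ≡ c i
      c-from-ℕ j<k eq = fromℕ< j<k , trans eq (cong w (sym (Fin.toℕ-fromℕ< j<k)))

      cycle-closed : ∀ i z → R z ≡ true → E (c i) z ≡ true → ∃ λ j → z ≡ c j
      cycle-closed i z Rz e with cycle-neighbours (toℕ i) (Fin.toℕ<n i) z Rz e
      ... | inj₁ eq                  = c-from-ℕ (next<k (toℕ i) (Fin.toℕ<n i)) eq
      ... | inj₂ (j , j<k , _ , eq) = c-from-ℕ j<k eq

      Rest : Fin n → Bool
      Rest x = R x ∧ not (does (on-cycle? x))

      Rest⇒R : ∀ {x} → Rest x ≡ true → R x ≡ true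
      Rest⇒R {x} p = proj₁ (∧-true {R x} p)

      Rest⇒off : ∀ {x} → Rest x ≡ true → ∀ i → x ≢ c i
      Rest⇒off {x} p i eq = contradiction
        (trans (sym (proj₂ (∧-true {R x} p))) (cong not (dec-true (on-cycle? x) (i , eq)))) λ ()

      off⇒Rest : ∀ {x} → R x ≡ true → ¬ (∃ λ i → x ≡ c i) → Rest x ≡ true
      off⇒Rest {x} Rx off = true-∧ Rx (cong not (dec-false (on-cycle? x) off))

      -- Vertices of the closed walk have both neighbours on it, so no edge joins it to the
      -- remaining vertices and their degrees survive its removal.
      Rest-two : TwoRegular Rest
      Rest-two .TwoRegular.regular x x∈ = trans (∑-cong λ w → cong ⟦_⟧ (pointwise w)) (regular x (Rest⇒R x∈))
        where
        pointwise : ∀ w → Rest w ∧ E x w ≡ R w ∧ E x w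
        pointwise w with on-cycle? w
        ... | no  _          = cong (_∧ E x w) (Bool.∧-identityʳ (R w))
        ... | yes (i , refl) = trans (cong (_∧ E x (c i)) (Bool.∧-zeroʳ (R (c i)))) (sym
          (Bool.¬-not λ eq → let j , x≡cj = cycle-closed i x (Rest⇒R x∈) (E-sym-true (proj₂ (∧-true {R (c i)} eq)))
                             in Rest⇒off x∈ j x≡cj))
      Rest-two .TwoRegular.triangle-free x y z x∈ y∈ z∈ = triangle-free x y z (Rest⇒R x∈) (Rest⇒R y∈) (Rest⇒R z∈)

      count-R : count R ≡ + k + count Rest
      count-R = begin
        count R ≡⟨ ∑-cong pointwise ⟩
        ∑ (λ x → ∑ (λ i → ⟦ does (x Fin.≟ c i) ⟧) + ⟦ Rest x ⟧) ≡⟨ ∑-+ _ _ ⟩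
        ∑ (λ x → ∑ λ i → ⟦ does (x Fin.≟ c i) ⟧) + count Rest ≡⟨ cong (_+ count Rest) (∑-comm _) ⟩
        ∑ (λ i → ∑ λ x → ⟦ does (x Fin.≟ c i) ⟧) + count Rest ≡⟨ cong (_+ count Rest) (∑-cong λ i → ∑-δ (c i)) ⟩
        ∑ (λ (i : Fin k) → 1ℤ) + count Rest ≡⟨ cong (_+ count Rest) (trans (∑-const {k} 1ℤ) (ℤ.*-identityʳ (+ k))) ⟩
        + k + count Rest ∎
        where
        pointwise : ∀ x → ⟦ R x ⟧ ≡ ∑ (λ i → ⟦ does (x Fin.≟ c i) ⟧) + ⟦ Rest x ⟧
        pointwise x with on-cycle? x
        ... | no off = trans (cong ⟦_⟧ (sym (Bool.∧-identityʳ (R x)))) (trans (sym (ℤ.+-identityˡ _))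
          (cong (_+ ⟦ R x ∧ true ⟧) (sym (∑-zero λ i → cong ⟦_⟧ (dec-false (x Fin.≟ c i) λ eq → off (i , eq))))))
        ... | yes (i₀ , refl) = trans (cong ⟦_⟧ (w∈R (toℕ i₀))) (sym (cong₂ _+_
          (trans (∑-cong λ i → cong ⟦_⟧ (same i)) (∑-δ i₀)) (cong ⟦_⟧ (Bool.∧-zeroʳ (R (c i₀))))))
          where
          same : ∀ i → does (c i₀ Fin.≟ c i) ≡ does (i Fin.≟ i₀)
          same i with i Fin.≟ i₀
          ... | yes refl = dec-true (c i Fin.≟ c i) refl
          ... | no i≢i₀  = dec-false (c i₀ Fin.≟ c i) λ eq → i≢i₀ (c-injective i i₀ (sym eq))

      cons : CycleDecomposition Rest → CycleDecomposition R
      cons D = record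
        { lengths = k ∷ D.lengths ; lengths≥4 = 4≤k ∷ D.lengths≥4
        ; sum≡count = trans (cong (λ s → + k + s) D.sum≡count) (sym count-R)
        ; φ = φ′ ; φ∈R = φ′∈R ; surjective = surj ; injective = inj ; adj⇒ = to ; adj⇐ = from }
        where
        module D = CycleDecomposition D
        φ′ : CycV (k ∷ D.lengths) → Fin n
        φ′ (zero  , p) = c p
        φ′ (suc i , p) = D.φ (i , p)
        φ′∈R : ∀ v → R (φ′ v) ≡ true
        φ′∈R (zero  , p) = w∈R (toℕ p)
        φ′∈R (suc i , p) = Rest⇒R (D.φ∈R (i , p))
        surj : ∀ x → R x ≡ true → ∃ λ v → φ′ v ≡ x
        surj x Rx with on-cycle? x
        ... | yes (i , eq) = (zero , i) , sym eq
        ... | no  off with D.surjective x (off⇒Rest Rx off)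
        ...   | (i , p) , eq = (suc i , p) , eq
        inj : ∀ u v → φ′ u ≡ φ′ v → u ≡ v
        inj (zero  , p) (zero  , q) eq = cong (zero ,_) (c-injective p q eq)
        inj (zero  , p) (suc j , q) eq = contradiction (sym eq) (Rest⇒off (D.φ∈R (j , q)) p)
        inj (suc i , p) (zero  , q) eq = contradiction eq (Rest⇒off (D.φ∈R (i , p)) q)
        inj (suc i , p) (suc j , q) eq with D.injective (i , p) (j , q) eq
        ... | refl = refl
        edge-from-cycle : ∀ p v → E (c p) (D.φ v) ≡ true → ∃ λ j → D.φ v ≡ c j
        edge-from-cycle p v e = cycle-closed p (D.φ v) (Rest⇒R (D.φ∈R v)) e
        to : ∀ u v → E (φ′ u) (φ′ v) ≡ true → Adj (k ∷ D.lengths) u v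
        to (zero  , p) (zero  , q) e = refl , cyc⇒ _ _ (Fin.toℕ<n p) (Fin.toℕ<n q) e
        to (zero  , p) (suc j , q) e = let i , eq = edge-from-cycle p (j , q) e in contradiction eq (Rest⇒off (D.φ∈R (j , q)) i)
        to (suc i , p) (zero  , q) e = let j , eq = edge-from-cycle q (i , p) (E-sym-true e) in contradiction eq (Rest⇒off (D.φ∈R (i , p)) j)
        to (suc i , p) (suc j , q) e with D.adj⇒ (i , p) (j , q) e
        ... | refl , a = refl , a
        from : ∀ u v → Adj (k ∷ D.lengths) u v → E (φ′ u) (φ′ v) ≡ true
        from (zero  , p) (zero  , q) (refl , a) = cyc⇐ _ _ (Fin.toℕ<n p) (Fin.toℕ<n q) a
        from (suc i , p) (suc j , q) (refl , a) = D.adj⇐ (i , p) (j , q) (refl , a)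

    empty : ∀ {R} → (∀ x → R x ≡ false) → CycleDecomposition R
    empty none = record
      { lengths = [] ; lengths≥4 = [] ; sum≡count = sym (∑-zero λ x → cong ⟦_⟧ (none x))
      ; φ = λ () ; φ∈R = λ () ; surjective = λ x Rx → contradiction (trans (sym Rx) (none x)) λ ()
      ; injective = λ () ; adj⇒ = λ () ; adj⇐ = λ () }

    decompose′ : ∀ fuel R → TwoRegular R → count R ≤ + fuel → CycleDecomposition R
    decompose′ fuel R R-two bound with any R
    ... | inj₂ none = empty none
    decompose′ zero R R-two bound | inj₁ (r , Rr) = contradiction
      (trans (sym (cong ⟦_⟧ Rr)) (∑-nonneg-≡0 (λ x → ⟦⟧-nonneg (R x)) (ℤ.≤-antisym bound (∑-nonneg λ x → ⟦⟧-nonneg (R x))) r)) λ ()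
    decompose′ (suc fuel) R R-two bound | inj₁ (r , Rr) = cons (decompose′ fuel Rest Rest-two smaller)
      where
      open Walk R R-two r Rr
      smaller : count Rest ≤ + fuel
      smaller = +-cancelʳ-≤ 1ℤ (subst₂ _≤_ (ℤ.+-comm 1ℤ (count Rest)) (ℤ.+-comm 1ℤ (+ fuel))
        (ℤ.≤-trans (ℤ.+-monoˡ-≤ (count Rest) (+≤+ (ℕ.≤-trans (ℕ.s≤s ℕ.z≤n) 4≤k))) (subst (_≤ + suc fuel) count-R bound)))

    decompose : ∀ R → TwoRegular R → CycleDecomposition R
    decompose R R-two = decompose′ n R R-two
      (ℤ.≤-trans (∑-mono λ x → ⟦⟧≤1 (R x)) (ℤ.≤-reflexive (trans (∑-const {n} 1ℤ) (ℤ.*-identityʳ (+ n)))))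

open CycleDecompositions

-- Sums over subsets, face numbers and the Euler characteristic

module SubsetSums where

  open import Data.Integer using (ℤ; +_; 0ℤ; 1ℤ; _+_; _*_; _-_; -_; _≤_; +≤+; -[1+_])

  ⇔⇒≡ : ∀ {p q} → (p ≡ true → q ≡ true) → (q ≡ true → p ≡ true) → p ≡ q
  ⇔⇒≡ {true}          p⇒q _   = sym (p⇒q refl)
  ⇔⇒≡ {false} {true}  _   q⇒p = q⇒p refl
  ⇔⇒≡ {false} {false} _   _   = refl

  ∑ˢ : ∀ {n} → (Subset n → ℤ) → ℤ
  ∑ˢ {zero}  F = F []
  ∑ˢ {suc n} F = ∑ˢ (λ τ → F (inside ∷ τ)) + ∑ˢ (λ τ → F (outside ∷ τ))

  ∑ˢ-cong : ∀ {n} {F G : Subset n → ℤ} → (∀ τ → F τ ≡ G τ) → ∑ˢ F ≡ ∑ˢ G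
  ∑ˢ-cong {zero}  F≡G = F≡G []
  ∑ˢ-cong {suc n} F≡G = cong₂ _+_ (∑ˢ-cong λ τ → F≡G (inside ∷ τ)) (∑ˢ-cong λ τ → F≡G (outside ∷ τ))

  ∑ˢ-+ : ∀ {n} (F G : Subset n → ℤ) → ∑ˢ (λ τ → F τ + G τ) ≡ ∑ˢ F + ∑ˢ G
  ∑ˢ-+ {zero}  F G = refl
  ∑ˢ-+ {suc n} F G = trans
    (cong₂ _+_ (∑ˢ-+ (λ τ → F (inside ∷ τ)) (λ τ → G (inside ∷ τ))) (∑ˢ-+ (λ τ → F (outside ∷ τ)) (λ τ → G (outside ∷ τ))))
    (interchange (∑ˢ (λ τ → F (inside ∷ τ))) (∑ˢ (λ τ → G (inside ∷ τ))) _ _)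
    where
    interchange : ∀ a b c d → (a + b) + (c + d) ≡ (a + c) + (b + d)
    interchange = solve-∀

  ∑ˢ-*ˡ : ∀ {n} c (F : Subset n → ℤ) → c * ∑ˢ F ≡ ∑ˢ (λ τ → c * F τ)
  ∑ˢ-*ˡ {zero}  c F = refl
  ∑ˢ-*ˡ {suc n} c F = trans (ℤ.*-distribˡ-+ c (∑ˢ (λ τ → F (inside ∷ τ))) _)
    (cong₂ _+_ (∑ˢ-*ˡ c (λ τ → F (inside ∷ τ))) (∑ˢ-*ˡ c (λ τ → F (outside ∷ τ))))

  ∑ˢ-zero : ∀ {n} {F : Subset n → ℤ} → (∀ τ → F τ ≡ 0ℤ) → ∑ˢ F ≡ 0ℤ
  ∑ˢ-zero {zero}  F≡0 = F≡0 []
  ∑ˢ-zero {suc n} F≡0 = cong₂ _+_ (∑ˢ-zero λ τ → F≡0 (inside ∷ τ)) (∑ˢ-zero λ τ → F≡0 (outside ∷ τ))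

  ∑ˢ-∑-comm : ∀ {n m} (F : Subset n → Fin m → ℤ) → ∑ˢ (λ τ → ∑ (F τ)) ≡ ∑ (λ i → ∑ˢ λ τ → F τ i)
  ∑ˢ-∑-comm {zero}  F = refl
  ∑ˢ-∑-comm {suc n} F = trans
    (cong₂ _+_ (∑ˢ-∑-comm λ τ → F (inside ∷ τ)) (∑ˢ-∑-comm λ τ → F (outside ∷ τ))) (sym (∑-+ _ _))

  sumᴸ : List ℤ → ℤ
  sumᴸ = foldr _+_ 0ℤ

  sumᴸ-++ : ∀ xs ys → sumᴸ (xs ++ ys) ≡ sumᴸ xs + sumᴸ ys
  sumᴸ-++ []       ys = sym (ℤ.+-identityˡ _)
  sumᴸ-++ (x ∷ xs) ys = trans (cong (λ s → x + s) (sumᴸ-++ xs ys)) (sym (ℤ.+-assoc x (sumᴸ xs) (sumᴸ ys)))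

  sumᴸ-allSubsets : ∀ {n} (F : Subset n → ℤ) → sumᴸ (List.map F (allSubsets n)) ≡ ∑ˢ F
  sumᴸ-allSubsets {zero}  F = ℤ.+-identityʳ (F [])
  sumᴸ-allSubsets {suc n} F = begin
    sumᴸ (List.map F (List.map (inside ∷_) S ++ List.map (outside ∷_) S))
      ≡⟨ cong sumᴸ (Listₚ.map-++ F (List.map (inside ∷_) S) (List.map (outside ∷_) S)) ⟩
    sumᴸ (List.map F (List.map (inside ∷_) S) ++ List.map F (List.map (outside ∷_) S))
      ≡⟨ sumᴸ-++ (List.map F (List.map (inside ∷_) S)) _ ⟩
    sumᴸ (List.map F (List.map (inside ∷_) S)) + sumᴸ (List.map F (List.map (outside ∷_) S))
      ≡⟨ cong₂ (λ xs ys → sumᴸ xs + sumᴸ ys) (Listₚ.map-∘ S) (Listₚ.map-∘ S) ⟨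
    sumᴸ (List.map (λ τ → F (inside ∷ τ)) S) + sumᴸ (List.map (λ τ → F (outside ∷ τ)) S)
      ≡⟨ cong₂ _+_ (sumᴸ-allSubsets λ τ → F (inside ∷ τ)) (sumᴸ-allSubsets λ τ → F (outside ∷ τ)) ⟩
    ∑ˢ F ∎
    where
    S = allSubsets n

  sumᴸ-filter : ∀ {A : Set} (p : A → Bool) (F : A → ℤ) xs →
    sumᴸ (List.map F (filterᵇ p xs)) ≡ sumᴸ (List.map (λ x → ⟦ p x ⟧ * F x) xs)
  sumᴸ-filter p F [] = refl
  sumᴸ-filter p F (x ∷ xs) with p x
  ... | true  = cong₂ _+_ (sym (ℤ.*-identityˡ (F x))) (sumᴸ-filter p F xs)
  ... | false = trans (sumᴸ-filter p F xs) (sym (ℤ.+-identityˡ _))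

  length-filter : ∀ {A : Set} (p : A → Bool) xs → + length (filterᵇ p xs) ≡ sumᴸ (List.map (λ x → ⟦ p x ⟧) xs)
  length-filter p [] = refl
  length-filter p (x ∷ xs) with p x
  ... | true  = cong (λ s → 1ℤ + s) (length-filter p xs)
  ... | false = trans (length-filter p xs) (sym (ℤ.+-identityˡ _))

  ∈-allSubsets : ∀ {n} (τ : Subset n) → τ ∈ᴸ allSubsets n
  ∈-allSubsets []            = here refl
  ∈-allSubsets (inside ∷ τ)  = ∈-++⁺ˡ (∈-map⁺ (inside ∷_) (∈-allSubsets τ))
  ∈-allSubsets (outside ∷ τ) = ∈-++⁺ʳ _ (∈-map⁺ (outside ∷_) (∈-allSubsets τ))

  maxSize-≡ : ∀ {n} (Γ : Cx n) k → (∀ τ → Γ τ ≡ true → ∣ τ ∣ ℕ.≤ k) → (∃ λ τ → Γ τ ≡ true × ∣ τ ∣ ≡ k) → maxSize Γ ≡ k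
  maxSize-≡ {n} Γ k bounded (τ , Γτ , ∣τ∣≡k) = ℕ.≤-antisym (upper (allSubsets n))
    (subst (ℕ._≤ maxSize Γ) ∣τ∣≡k (lower (allSubsets n) (∈-allSubsets τ)))
    where
    size : List (Subset n) → ℕ
    size xs = foldr _⊔_ 0 (List.map ∣_∣ (filterᵇ Γ xs))
    upper : ∀ xs → size xs ℕ.≤ k
    upper [] = ℕ.z≤n
    upper (σ ∷ xs) with Γ σ in Γσ
    ... | true  = ℕ.⊔-lub (bounded σ Γσ) (upper xs)
    ... | false = upper xs
    lower : ∀ xs → τ ∈ᴸ xs → ∣ τ ∣ ℕ.≤ size xs
    lower (σ ∷ xs) (here refl) rewrite Γτ = ℕ.m≤m⊔n ∣ σ ∣ (size xs)
    lower (σ ∷ xs) (there τ∈) with Γ σ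
    ... | true  = ℕ.≤-trans (lower xs τ∈) (ℕ.m≤n⊔m ∣ σ ∣ (size xs))
    ... | false = lower xs τ∈

  ∣p∣≡∑ : ∀ {n} (τ : Subset n) → + ∣ τ ∣ ≡ ∑ (λ i → ⟦ lookup τ i ⟧)
  ∣p∣≡∑ []            = sym ∑-[]
  ∣p∣≡∑ (inside ∷ τ)  = trans (cong (λ s → 1ℤ + s) (∣p∣≡∑ τ)) (sym (∑-∷ _))
  ∣p∣≡∑ (outside ∷ τ) = trans (∣p∣≡∑ τ) (trans (sym (ℤ.+-identityˡ _)) (sym (∑-∷ _)))

  -- Adding `i` is a bijection from the subsets avoiding `i` onto those containing it; this is how
  -- faces through `i` become faces of the link.
  ∑ˢ-insert : ∀ {n} i (F : Subset n → ℤ) →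
    ∑ˢ (λ τ → ⟦ lookup τ i ⟧ * F τ) ≡ ∑ˢ (λ τ → ⟦ not (lookup τ i) ⟧ * F (τ ∪ ⁅ i ⁆))
  ∑ˢ-insert {suc n} zero F = trans
    (cong₂ _+_ (∑ˢ-cong λ τ → cong (λ σ → 1ℤ * F (inside ∷ σ)) (sym (Sub.∪-identityʳ τ))) (∑ˢ-zero {n} λ τ → refl))
    (trans (ℤ.+-comm inserted 0ℤ) (cong (_+ inserted) (sym (∑ˢ-zero {n} λ τ → refl))))
    where
    inserted = ∑ˢ λ τ → 1ℤ * F (inside ∷ (τ ∪ ∅))
  ∑ˢ-insert (suc i) F = cong₂ _+_ (∑ˢ-insert i λ τ → F (inside ∷ τ)) (∑ˢ-insert i λ τ → F (outside ∷ τ))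

  ∣p∩⁅i⁆∣ : ∀ {n} (τ : Subset n) i → (∣ τ ∩ ⁅ i ⁆ ∣ ≡ᵇ 0) ≡ not (lookup τ i)
  ∣p∩⁅i⁆∣ (inside ∷ τ) zero = refl
  ∣p∩⁅i⁆∣ {suc n} (outside ∷ τ) zero = cong (_≡ᵇ 0) (trans (cong ∣_∣ (Sub.∩-zeroʳ τ)) (Sub.∣⊥∣≡0 n))
  ∣p∩⁅i⁆∣ (inside  ∷ τ) (suc i) = ∣p∩⁅i⁆∣ τ i
  ∣p∩⁅i⁆∣ (outside ∷ τ) (suc i) = ∣p∩⁅i⁆∣ τ i

  disjoint⇒∣p∪q∣ : ∀ {n} (p q : Subset n) → ∣ p ∩ q ∣ ≡ 0 → ∣ p ∪ q ∣ ≡ ∣ p ∣ ℕ.+ ∣ q ∣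
  disjoint⇒∣p∪q∣ []            []            _  = refl
  disjoint⇒∣p∪q∣ (inside  ∷ p) (outside ∷ q) eq = cong suc (disjoint⇒∣p∪q∣ p q eq)
  disjoint⇒∣p∪q∣ (outside ∷ p) (inside  ∷ q) eq = trans (cong suc (disjoint⇒∣p∪q∣ p q eq)) (sym (ℕ.+-suc ∣ p ∣ ∣ q ∣))
  disjoint⇒∣p∪q∣ (outside ∷ p) (outside ∷ q) eq = disjoint⇒∣p∪q∣ p q eq

  i∈p⇒0<∣p∣ : ∀ {n i} {p : Subset n} → i ∈ p → 0 ℕ.< ∣ p ∣
  i∈p⇒0<∣p∣ {i = i} i∈p = subst (ℕ._≤ _) (Sub.∣⁅x⁆∣≡1 i)
    (Sub.p⊆q⇒∣p∣≤∣q∣ λ x∈ → subst (_∈ _) (sym (Sub.x∈⁅y⁆⇒x≡y i x∈)) i∈p)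

  ∣p∩q∣≡0⇒disjoint : ∀ {n} (p q : Subset n) → ∣ p ∩ q ∣ ≡ 0 → ∀ {i} → i ∈ p → i ∉ q
  ∣p∩q∣≡0⇒disjoint p q eq i∈p i∈q = contradiction (sym eq) (ℕ.<⇒≢ (i∈p⇒0<∣p∣ (Sub.x∈p∩q⁺ (i∈p , i∈q))))

  disjoint⇒∣p∩q∣≡0 : ∀ {n} (p q : Subset n) → (∀ {i} → i ∈ p → i ∉ q) → ∣ p ∩ q ∣ ≡ 0
  disjoint⇒∣p∩q∣≡0 {n} p q disj = trans (cong ∣_∣ (Sub.Empty-unique λ { (i , i∈) →
    let i∈p , i∈q = Sub.x∈p∩q⁻ p q i∈ in disj i∈p i∈q })) (Sub.∣⊥∣≡0 n)

  ∪-size : ∀ {n} (τ : Subset n) i → i ∉ τ → ∣ τ ∪ ⁅ i ⁆ ∣ ≡ suc ∣ τ ∣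
  ∪-size τ i i∉τ = trans (disjoint⇒∣p∪q∣ τ ⁅ i ⁆ (disjoint⇒∣p∩q∣≡0 τ ⁅ i ⁆
      λ j∈τ j∈i → i∉τ (subst (_∈ τ) (Sub.x∈⁅y⁆⇒x≡y i j∈i) j∈τ)))
    (trans (cong (∣ τ ∣ ℕ.+_) (Sub.∣⁅x⁆∣≡1 i)) (ℕ.+-comm ∣ τ ∣ 1))

  module _ {n : ℕ} (Γ : Cx n) where

    lk⇒ : ∀ σ τ → lk Γ σ τ ≡ true → Γ (τ ∪ σ) ≡ true × ∣ τ ∩ σ ∣ ≡ 0
    lk⇒ σ τ eq = let Γ∪ , disj = ∧-true {Γ (τ ∪ σ)} eq in Γ∪ , ℕ.≡ᵇ⇒≡ _ 0 (subst T (sym disj) _)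

    lk⇐ : ∀ σ τ → Γ (τ ∪ σ) ≡ true → ∣ τ ∩ σ ∣ ≡ 0 → lk Γ σ τ ≡ true
    lk⇐ σ τ Γ∪ disj = true-∧ Γ∪ (cong (_≡ᵇ 0) disj)

    faceCount : ℕ → ℤ
    faceCount k = ∑ˢ λ τ → ⟦ Γ τ ∧ (∣ τ ∣ ≡ᵇ k) ⟧

  faceCount-0 : ∀ {n} (Γ : Cx n) → faceCount Γ 0 ≡ ⟦ Γ ∅ ⟧
  faceCount-0 {zero}  Γ = cong ⟦_⟧ (Bool.∧-identityʳ (Γ []))
  faceCount-0 {suc n} Γ = trans
    (cong₂ _+_ (∑ˢ-zero {n} λ τ → cong ⟦_⟧ (Bool.∧-zeroʳ (Γ (inside ∷ τ)))) (faceCount-0 λ τ → Γ (outside ∷ τ)))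
    (ℤ.+-identityˡ _)

  -- Double counting of the pairs (τ, i) with i ∈ τ and |τ| = k + 1.
  faceCount-lk : ∀ {n} (Γ : Cx n) k → + suc k * faceCount Γ (suc k) ≡ ∑ (λ i → faceCount (lk Γ ⁅ i ⁆) k)
  faceCount-lk Γ k = begin
    + suc k * faceCount Γ (suc k)
      ≡⟨ ∑ˢ-*ˡ (+ suc k) (λ τ → ⟦ Γ τ ∧ (∣ τ ∣ ≡ᵇ suc k) ⟧) ⟩
    ∑ˢ (λ τ → + suc k * ⟦ Γ τ ∧ (∣ τ ∣ ≡ᵇ suc k) ⟧)
      ≡⟨ ∑ˢ-cong (λ τ → trans (size τ) (trans (cong (_* F τ) (∣p∣≡∑ τ)) (∑-*ʳ (F τ) _))) ⟩
    ∑ˢ (λ τ → ∑ λ i → ⟦ lookup τ i ⟧ * F τ)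
      ≡⟨ ∑ˢ-∑-comm (λ τ i → ⟦ lookup τ i ⟧ * F τ) ⟩
    ∑ (λ i → ∑ˢ λ τ → ⟦ lookup τ i ⟧ * F τ)
      ≡⟨ ∑-cong (λ i → trans (∑ˢ-insert i F) (∑ˢ-cong (link i))) ⟩
    ∑ (λ i → faceCount (lk Γ ⁅ i ⁆) k) ∎
    where
    F : Subset _ → ℤ
    F τ = ⟦ Γ τ ∧ (∣ τ ∣ ≡ᵇ suc k) ⟧
    size : ∀ τ → + suc k * F τ ≡ + ∣ τ ∣ * F τ
    size τ = trans (ℤ.*-comm (+ suc k) (F τ)) (trans
      (⟦⟧-*-cong (Γ τ ∧ (∣ τ ∣ ≡ᵇ suc k)) λ eq → cong +_ (sym (ℕ.≡ᵇ⇒≡ ∣ τ ∣ (suc k) (subst T (sym (proj₂ (∧-true {Γ τ} eq))) _))))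
      (ℤ.*-comm (F τ) (+ ∣ τ ∣)))
    link : ∀ i τ → ⟦ not (lookup τ i) ⟧ * F (τ ∪ ⁅ i ⁆) ≡ ⟦ lk Γ ⁅ i ⁆ τ ∧ (∣ τ ∣ ≡ᵇ k) ⟧
    link i τ with lookup τ i in eq
    ... | true  = cong ⟦_⟧ (sym (cong (_∧ (∣ τ ∣ ≡ᵇ k)) (trans (cong (Γ (τ ∪ ⁅ i ⁆) ∧_)
      (trans (∣p∩⁅i⁆∣ τ i) (cong not eq))) (Bool.∧-zeroʳ _))))
    ... | false = trans (ℤ.*-identityˡ _) (cong ⟦_⟧ (cong₂ _∧_
      (trans (sym (Bool.∧-identityʳ _)) (cong (Γ (τ ∪ ⁅ i ⁆) ∧_) (sym disjᵇ)))
      (cong (_≡ᵇ suc k) (trans (disjoint⇒∣p∪q∣ τ ⁅ i ⁆ (ℕ.≡ᵇ⇒≡ _ 0 (subst T (sym disjᵇ) _)))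
        (trans (cong (∣ τ ∣ ℕ.+_) (Sub.∣⁅x⁆∣≡1 i)) (ℕ.+-comm ∣ τ ∣ 1))))))
      where
      disjᵇ : (∣ τ ∩ ⁅ i ⁆ ∣ ≡ᵇ 0) ≡ true
      disjᵇ = trans (∣p∩⁅i⁆∣ τ i) (cong not eq)

  -- The signs are the values of `sgn` at 0, 1, 2, 3. One formula serves the 2-dimensional links of
  -- vertices and the 0-dimensional links of triangles, where the last two counts vanish.
  χ̃-dim≤2 : ∀ {n} (Γ : Cx n) → (∀ τ → Γ τ ≡ true → ∣ τ ∣ ℕ.≤ 3) →
    χ̃ Γ ≡ (- 1ℤ * faceCount Γ 0 + faceCount Γ 1) + (- 1ℤ * faceCount Γ 2 + faceCount Γ 3)
  χ̃-dim≤2 {n} Γ bounded = begin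
    χ̃ Γ ≡⟨ sumᴸ-filter Γ (λ τ → sgn ∣ τ ∣) (allSubsets n) ⟩
    sumᴸ (List.map (λ τ → ⟦ Γ τ ⟧ * sgn ∣ τ ∣) (allSubsets n)) ≡⟨ sumᴸ-allSubsets (λ τ → ⟦ Γ τ ⟧ * sgn ∣ τ ∣) ⟩
    ∑ˢ (λ τ → ⟦ Γ τ ⟧ * sgn ∣ τ ∣) ≡⟨ ∑ˢ-cong (λ τ → pointwise (Γ τ) ∣ τ ∣ (bounded τ)) ⟩
    ∑ˢ (λ τ → (- 1ℤ * ⟦ f 0 τ ⟧ + ⟦ f 1 τ ⟧) + (- 1ℤ * ⟦ f 2 τ ⟧ + ⟦ f 3 τ ⟧)) ≡⟨ ∑ˢ-+ _ (λ τ → - 1ℤ * ⟦ f 2 τ ⟧ + ⟦ f 3 τ ⟧) ⟩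
    ∑ˢ (λ τ → - 1ℤ * ⟦ f 0 τ ⟧ + ⟦ f 1 τ ⟧) + ∑ˢ (λ τ → - 1ℤ * ⟦ f 2 τ ⟧ + ⟦ f 3 τ ⟧)
      ≡⟨ cong₂ _+_ (pair 0 1) (pair 2 3) ⟩
    (- 1ℤ * faceCount Γ 0 + faceCount Γ 1) + (- 1ℤ * faceCount Γ 2 + faceCount Γ 3) ∎
    where
    f : ℕ → Subset n → Bool
    f k τ = Γ τ ∧ (∣ τ ∣ ≡ᵇ k)
    pair : ∀ j k → ∑ˢ (λ τ → - 1ℤ * ⟦ f j τ ⟧ + ⟦ f k τ ⟧) ≡ - 1ℤ * faceCount Γ j + faceCount Γ k
    pair j k = trans (∑ˢ-+ (λ τ → - 1ℤ * ⟦ f j τ ⟧) (λ τ → ⟦ f k τ ⟧)) (cong (_+ faceCount Γ k) (sym (∑ˢ-*ˡ (- 1ℤ) λ τ → ⟦ f j τ ⟧)))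
    pointwise : ∀ g m → (g ≡ true → m ℕ.≤ 3) → ⟦ g ⟧ * sgn m ≡
      (- 1ℤ * ⟦ g ∧ (m ≡ᵇ 0) ⟧ + ⟦ g ∧ (m ≡ᵇ 1) ⟧) + (- 1ℤ * ⟦ g ∧ (m ≡ᵇ 2) ⟧ + ⟦ g ∧ (m ≡ᵇ 3) ⟧)
    pointwise false m _ = refl
    pointwise true 0 _ = refl
    pointwise true 1 _ = refl
    pointwise true 2 _ = refl
    pointwise true 3 _ = refl
    pointwise true (suc (suc (suc (suc m)))) b = contradiction (b refl) λ { (ℕ.s≤s (ℕ.s≤s (ℕ.s≤s ()))) }

  f₁≡faceCount : ∀ {n} (Γ : Cx n) → + f₁ Γ ≡ faceCount Γ 2
  f₁≡faceCount {n} Γ = trans (length-filter (λ σ → Γ σ ∧ (∣ σ ∣ ≡ᵇ 2)) (allSubsets n)) (sumᴸ-allSubsets λ τ → ⟦ Γ τ ∧ (∣ τ ∣ ≡ᵇ 2) ⟧)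

  Clique : ∀ {n} → (Fin n → Fin n → Bool) → Subset n → Set
  Clique E τ = ∀ {i j} → i ∈ τ → j ∈ τ → i ≢ j → E i j ≡ true

  -- Links of pure flag complexes

  module FlagLinks {n : ℕ} (E : Fin n → Fin n → Bool) (E-sym : ∀ a b → E a b ≡ E b a) (E-irrefl : ∀ a → E a a ≡ false) where

    -- Iterated links of a flag complex: Γ consists of the cliques inside N, or of nothing when c is false.
    record FlagPure (k : ℕ) (c : Bool) (N : Fin n → Bool) (Γ : Cx n) : Set where
      field
        face⇒    : ∀ τ → Γ τ ≡ true → c ≡ true × (∀ {i} → i ∈ τ → N i ≡ true) × Clique E τ
        face⇐    : ∀ τ → c ≡ true → (∀ {i} → i ∈ τ → N i ≡ true) → Clique E τ → Γ τ ≡ true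
        bounded  : ∀ τ → Γ τ ≡ true → ∣ τ ∣ ℕ.≤ k
        extend   : ∀ τ → Γ τ ≡ true → ∣ τ ∣ ℕ.< k → ∃ λ i → i ∉ τ × Γ (τ ∪ ⁅ i ⁆) ≡ true

      ∅∈ : Γ ∅ ≡ c
      ∅∈ = ⇔⇒≡ (λ Γ∅ → proj₁ (face⇒ ∅ Γ∅))
        λ c≡ → face⇐ ∅ c≡ (λ i∈ → contradiction i∈ Sub.∉⊥) λ i∈ → contradiction i∈ Sub.∉⊥

      extend-∅ : c ≡ true → 0 ℕ.< k → ∃ λ i → N i ≡ true
      extend-∅ c≡ 0<k with extend ∅ (trans ∅∈ c≡) (subst (ℕ._< k) (sym (Sub.∣⊥∣≡0 n)) 0<k)
      ... | i , _ , Γi = i , proj₁ (proj₂ (face⇒ _ Γi)) (Sub.x∈p∪q⁺ (inj₂ (Sub.x∈⁅x⁆ i)))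

      full-face : c ≡ true → ∃ λ τ → Γ τ ≡ true × ∣ τ ∣ ≡ k
      full-face c≡ = grow k ∅ (trans ∅∈ c≡) (trans (cong (ℕ._+ k) (Sub.∣⊥∣≡0 n)) refl)
        where
        grow : ∀ j τ → Γ τ ≡ true → ∣ τ ∣ ℕ.+ j ≡ k → ∃ λ τ → Γ τ ≡ true × ∣ τ ∣ ≡ k
        grow zero    τ Γτ eq = τ , Γτ , trans (sym (ℕ.+-identityʳ ∣ τ ∣)) eq
        grow (suc j) τ Γτ eq with extend τ Γτ (subst (∣ τ ∣ ℕ.<_) eq (ℕ.m<m+n ∣ τ ∣ (ℕ.s≤s ℕ.z≤n)))
        ... | i , i∉τ , Γτi = grow j (τ ∪ ⁅ i ⁆) Γτi (trans (cong (ℕ._+ j) (∪-size τ i i∉τ)) (trans (sym (ℕ.+-suc ∣ τ ∣ j)) eq))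

      maxSize≡ : c ≡ true → maxSize Γ ≡ k
      maxSize≡ c≡ = maxSize-≡ Γ k bounded (full-face c≡)

    open FlagPure

    -- `c′` and `N′` are fixed up to equivalence only, so the caller chooses their Boolean form. A
    -- general `σ` is allowed because the Euler relation for a triangle concerns `lk Δ σ` and not an
    -- iterated vertex link.
    lk-FlagPure : ∀ {j c c′ N N′ Γ} σ → FlagPure (j ℕ.+ ∣ σ ∣) c N Γ →
      (c′ ≡ true → c ≡ true × (∀ {i} → i ∈ σ → N i ≡ true) × Clique E σ) →
      (c ≡ true → (∀ {i} → i ∈ σ → N i ≡ true) → Clique E σ → c′ ≡ true) →
      (∀ i → N′ i ≡ true → N i ≡ true × (∀ {v} → v ∈ σ → E v i ≡ true)) →
      (∀ i → N i ≡ true → (∀ {v} → v ∈ σ → E v i ≡ true) → N′ i ≡ true) →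
      FlagPure j c′ N′ (lk Γ σ)
    lk-FlagPure {j} {c} {c′} {N} {N′} {Γ} σ P c⇒ c⇐ N⇒ N⇐ = record
      { face⇒ = to ; face⇐ = from ; bounded = bound ; extend = ext }
      where
      to : ∀ τ → lk Γ σ τ ≡ true → c′ ≡ true × (∀ {i} → i ∈ τ → N′ i ≡ true) × Clique E τ
      to τ lkτ with lk⇒ Γ σ τ lkτ
      ... | Γ∪ , disj with face⇒ P (τ ∪ σ) Γ∪
      ...   | c≡ , inN , clique = c⇐ c≡ (λ i∈ → inN (ʳ i∈)) (λ i∈ j∈ → clique (ʳ i∈) (ʳ j∈)) ,
        (λ {i} i∈ → N⇐ i (inN (ˡ i∈)) λ {v} v∈ →
          clique (ʳ v∈) (ˡ i∈) λ { refl → ∣p∩q∣≡0⇒disjoint τ σ disj i∈ v∈ }) ,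
        λ i∈ j∈ → clique (ˡ i∈) (ˡ j∈)
        where
        ˡ : ∀ {i} → i ∈ τ → i ∈ τ ∪ σ
        ˡ i∈ = Sub.x∈p∪q⁺ (inj₁ i∈)
        ʳ : ∀ {i} → i ∈ σ → i ∈ τ ∪ σ
        ʳ i∈ = Sub.x∈p∪q⁺ (inj₂ i∈)
      from : ∀ τ → c′ ≡ true → (∀ {i} → i ∈ τ → N′ i ≡ true) → Clique E τ → lk Γ σ τ ≡ true
      from τ c′≡ inN′ clique with c⇒ c′≡
      ... | c≡ , inN , σ-clique = lk⇐ Γ σ τ
        (face⇐ P (τ ∪ σ) c≡ (λ i∈ → [ (λ i∈τ → proj₁ (N⇒ _ (inN′ i∈τ))) , inN ]′ (Sub.x∈p∪q⁻ τ σ i∈)) ∪-clique)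
        (disjoint⇒∣p∩q∣≡0 τ σ λ {i} i∈τ i∈σ →
          contradiction (trans (sym (proj₂ (N⇒ i (inN′ i∈τ)) i∈σ)) (E-irrefl i)) λ ())
        where
        ∪-clique : Clique E (τ ∪ σ)
        ∪-clique {i} {j} i∈ j∈ i≢j with Sub.x∈p∪q⁻ τ σ i∈ | Sub.x∈p∪q⁻ τ σ j∈
        ... | inj₁ i∈τ | inj₁ j∈τ = clique i∈τ j∈τ i≢j
        ... | inj₁ i∈τ | inj₂ j∈σ = trans (E-sym i j) (proj₂ (N⇒ i (inN′ i∈τ)) j∈σ)
        ... | inj₂ i∈σ | inj₁ j∈τ = proj₂ (N⇒ j (inN′ j∈τ)) i∈σ
        ... | inj₂ i∈σ | inj₂ j∈σ = σ-clique i∈σ j∈σ i≢j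
      bound : ∀ τ → lk Γ σ τ ≡ true → ∣ τ ∣ ℕ.≤ j
      bound τ lkτ with lk⇒ Γ σ τ lkτ
      ... | Γ∪ , disj = ℕ.+-cancelʳ-≤ ∣ σ ∣ ∣ τ ∣ j (subst (ℕ._≤ j ℕ.+ ∣ σ ∣) (disjoint⇒∣p∪q∣ τ σ disj) (bounded P (τ ∪ σ) Γ∪))
      ext : ∀ τ → lk Γ σ τ ≡ true → ∣ τ ∣ ℕ.< j → ∃ λ i → i ∉ τ × lk Γ σ (τ ∪ ⁅ i ⁆) ≡ true
      ext τ lkτ ∣τ∣<j with lk⇒ Γ σ τ lkτ
      ... | Γ∪ , disj with extend P (τ ∪ σ) Γ∪ (subst (ℕ._< j ℕ.+ ∣ σ ∣) (sym (disjoint⇒∣p∪q∣ τ σ disj)) (ℕ.+-monoˡ-< ∣ σ ∣ ∣τ∣<j))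
      ...   | i , i∉ , Γ∪i = i , (λ i∈ → i∉ (Sub.x∈p∪q⁺ (inj₁ i∈))) , lk⇐ Γ σ (τ ∪ ⁅ i ⁆)
        (subst (λ ρ → Γ ρ ≡ true) reorder Γ∪i)
        (disjoint⇒∣p∩q∣≡0 (τ ∪ ⁅ i ⁆) σ λ {v} v∈ v∈σ → [ (λ v∈τ → ∣p∩q∣≡0⇒disjoint τ σ disj v∈τ v∈σ)
          , (λ v∈i → i∉ (Sub.x∈p∪q⁺ (inj₂ (subst (_∈ σ) (Sub.x∈⁅y⁆⇒x≡y i v∈i) v∈σ)))) ]′ (Sub.x∈p∪q⁻ τ ⁅ i ⁆ v∈))
        where
        reorder : (τ ∪ σ) ∪ ⁅ i ⁆ ≡ (τ ∪ ⁅ i ⁆) ∪ σ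
        reorder = trans (Sub.∪-assoc τ σ ⁅ i ⁆) (trans (cong (τ ∪_) (Sub.∪-comm σ ⁅ i ⁆)) (sym (Sub.∪-assoc τ ⁅ i ⁆ σ)))

    -- If `v` is not a vertex of `Γ`, the flag `c ∧ N v` is false and the link is void. Face counts
    -- of iterated links thus hold for every tuple of vertices, and sums over tuples need no side
    -- conditions.
    lk-vertex : ∀ {j c N Γ} v → FlagPure (suc j) c N Γ → FlagPure j (c ∧ N v) (λ i → N i ∧ E v i) (lk Γ ⁅ v ⁆)
    lk-vertex {j} {c} {N} {Γ} v P = lk-FlagPure ⁅ v ⁆
      (subst (λ k → FlagPure k c N Γ) (trans (ℕ.+-comm 1 j) (cong (j ℕ.+_) (sym (Sub.∣⁅x⁆∣≡1 v)))) P)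
      (λ eq → let c≡ , Nv = ∧-true {c} eq in
        c≡ , (λ i∈ → subst (λ i → N i ≡ true) (sym (Sub.x∈⁅y⁆⇒x≡y v i∈)) Nv) ,
        λ i∈ j∈ i≢j → contradiction (trans (Sub.x∈⁅y⁆⇒x≡y v i∈) (sym (Sub.x∈⁅y⁆⇒x≡y v j∈))) i≢j)
      (λ c≡ inN _ → true-∧ c≡ (inN (Sub.x∈⁅x⁆ v)))
      (λ i eq → let Ni , vi = ∧-true {N i} eq in
        Ni , λ u∈ → subst (λ u → E u i ≡ true) (sym (Sub.x∈⁅y⁆⇒x≡y v u∈)) vi)
      (λ i Ni vi → true-∧ Ni (vi (Sub.x∈⁅x⁆ v)))

    bounded-0 : ∀ {c N Γ} → FlagPure 0 c N Γ → ∀ w → c ∧ N w ≡ false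
    bounded-0 {c} {N} {Γ} P w = Bool.¬-not λ eq → let c≡ , Nw = ∧-true {c} eq in
      contradiction (subst (ℕ._≤ 0) (Sub.∣⁅x⁆∣≡1 w) (bounded P ⁅ w ⁆ (face⇐ P ⁅ w ⁆ c≡
        (λ i∈ → subst (λ i → N i ≡ true) (sym (Sub.x∈⁅y⁆⇒x≡y w i∈)) Nw)
        λ i∈ j∈ i≢j → contradiction (trans (Sub.x∈⁅y⁆⇒x≡y w i∈) (sym (Sub.x∈⁅y⁆⇒x≡y w j∈))) i≢j))) λ ()

    faceCount-1 : ∀ {j c N Γ} → FlagPure (suc j) c N Γ → faceCount Γ 1 ≡ ∑ (λ i → ⟦ c ∧ N i ⟧)
    faceCount-1 {Γ = Γ} P = trans (sym (ℤ.*-identityˡ _)) (trans (faceCount-lk Γ 0)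
      (∑-cong λ i → trans (faceCount-0 (lk Γ ⁅ i ⁆)) (cong ⟦_⟧ (∅∈ (lk-vertex i P)))))

    faceCount-2 : ∀ {j c N Γ} → FlagPure (2 ℕ.+ j) c N Γ →
      + 2 * faceCount Γ 2 ≡ ∑ (λ a → ∑ λ b → ⟦ (c ∧ N a) ∧ (N b ∧ E a b) ⟧)
    faceCount-2 {Γ = Γ} P = trans (faceCount-lk Γ 1) (∑-cong λ a → faceCount-1 (lk-vertex a P))

    faceCount-3 : ∀ {j c N Γ} → FlagPure (3 ℕ.+ j) c N Γ →
      + 6 * faceCount Γ 3 ≡ ∑ (λ a → ∑ λ b → ∑ λ d → ⟦ ((c ∧ N a) ∧ (N b ∧ E a b)) ∧ ((N d ∧ E a d) ∧ E b d) ⟧)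
    faceCount-3 {Γ = Γ} P = begin
      -- The 6 orderings of a triangle arise as 3 choices of the first vertex and 2 orderings of the
      -- opposite edge in its link.
      + 6 * faceCount Γ 3                      ≡⟨ ℤ.*-assoc (+ 2) (+ 3) (faceCount Γ 3) ⟩
      + 2 * (+ 3 * faceCount Γ 3)              ≡⟨ cong (+ 2 *_) (faceCount-lk Γ 2) ⟩
      + 2 * ∑ (λ a → faceCount (lk Γ ⁅ a ⁆) 2) ≡⟨ ∑-*ˡ (+ 2) _ ⟩
      ∑ (λ a → + 2 * faceCount (lk Γ ⁅ a ⁆) 2) ≡⟨ ∑-cong (λ a → faceCount-2 (lk-vertex a P)) ⟩
      _ ∎

    faceCount-bounded : ∀ {k c N Γ} → FlagPure k c N Γ → ∀ m → k ℕ.< m → faceCount Γ m ≡ 0ℤ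
    faceCount-bounded {k} {Γ = Γ} P m k<m = ∑ˢ-zero λ τ → cong ⟦_⟧ (Bool.¬-not λ eq →
      let Γτ , size = ∧-true {Γ τ} eq in
      contradiction (ℕ.<-≤-trans k<m (subst (ℕ._≤ k) (ℕ.≡ᵇ⇒≡ ∣ τ ∣ m (subst T (sym size) _)) (bounded P τ Γτ))) (ℕ.<-irrefl refl))

open SubsetSums

-- From Eulerian flag complexes to the counting hypotheses

module Extremality where

  open import Data.Integer using (ℤ; +_; 0ℤ; 1ℤ; _+_; _*_; _-_; -_; _≤_; +≤+; -[1+_])

  record Halves (n : ℕ) : Set where
    field
      h h′     : ℕ
      n≡h+h′   : n ≡ h ℕ.+ h′
      balanced : h′ ≡ h ⊎ h′ ≡ suc h
      floor    : h ≡ n / 2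
      ceiling  : h′ ≡ n ℕ.∸ n / 2
      quarter  : n ℕ.* n / 4 ≡ h ℕ.* h′

  halves : ∀ n → Halves n
  halves n with n % 2 | m≡m%n+[m/n]*n n 2 | m%n<n n 2
  ... | 0 | n≡ | _ = record
    { h = h ; h′ = h ; n≡h+h′ = n≡2h ; balanced = inj₁ refl ; floor = refl
    ; ceiling = sym (trans (cong (ℕ._∸ h) n≡2h) (ℕ.m+n∸m≡n h h))
    ; quarter = trans (cong (_/ 4) (trans (cong₂ ℕ._*_ n≡2h n≡2h) (square h))) (m*n/n≡m (h ℕ.* h) 4) }
    where
    h = n / 2
    double : ∀ h → h ℕ.* 2 ≡ h ℕ.+ h
    double = ℕ-Solver.solve-∀
    square : ∀ h → (h ℕ.+ h) ℕ.* (h ℕ.+ h) ≡ h ℕ.* h ℕ.* 4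
    square = ℕ-Solver.solve-∀
    n≡2h : n ≡ h ℕ.+ h
    n≡2h = trans n≡ (double h)
  ... | 1 | n≡ | _ = record
    { h = h ; h′ = suc h ; n≡h+h′ = n≡2h+1 ; balanced = inj₂ refl ; floor = refl
    ; ceiling = sym (trans (cong (ℕ._∸ h) n≡2h+1) (ℕ.m+n∸m≡n h (suc h)))
    -- Here n² = 4h(h + 1) + 1, and the division discards the 1.
    ; quarter = trans (cong (_/ 4) (trans (cong₂ ℕ._*_ n≡2h+1 n≡2h+1) (square h)))
        (trans (+-distrib-/-∣ʳ 1 (n∣m*n (h ℕ.* suc h) {4})) (m*n/n≡m (h ℕ.* suc h) 4)) }
    where
    h = n / 2
    double : ∀ h → 1 ℕ.+ h ℕ.* 2 ≡ h ℕ.+ suc h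
    double = ℕ-Solver.solve-∀
    square : ∀ h → (h ℕ.+ suc h) ℕ.* (h ℕ.+ suc h) ≡ 1 ℕ.+ h ℕ.* suc h ℕ.* 4
    square = ℕ-Solver.solve-∀
    n≡2h+1 : n ≡ h ℕ.+ suc h
    n≡2h+1 = trans n≡ (double h)
  ... | suc (suc _) | _ | ℕ.s≤s (ℕ.s≤s ())

  module FlagComplex {n : ℕ} (Δ : Cx n) (complex : IsComplex Δ) (flag : IsFlag Δ) where

    -- The second conjunct excludes loops: for equal arguments the union is a singleton, which is a
    -- face.
    E : Fin n → Fin n → Bool
    E a b = Δ (⁅ a ⁆ ∪ ⁅ b ⁆) ∧ not (does (a Fin.≟ b))

    E-sym : ∀ a b → E a b ≡ E b a
    E-sym a b = cong₂ _∧_ (cong Δ (Sub.∪-comm ⁅ a ⁆ ⁅ b ⁆)) (cong not (⇔⇒≡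
      (λ eq → dec-true (b Fin.≟ a) (sym (does-true (a Fin.≟ b) eq)))
      (λ eq → dec-true (a Fin.≟ b) (sym (does-true (b Fin.≟ a) eq)))))

    E-irrefl : ∀ a → E a a ≡ false
    E-irrefl a = trans (cong (λ p → Δ (⁅ a ⁆ ∪ ⁅ a ⁆) ∧ not p) (dec-true (a Fin.≟ a) refl)) (Bool.∧-zeroʳ _)

    open FlagLinks E E-sym E-irrefl
    open Cycles E E-sym E-irrefl

    face⇒clique : ∀ τ → Δ τ ≡ true → Clique E τ
    face⇒clique τ Δτ {i} {j} i∈ j∈ i≢j = true-∧
      (proj₁ complex (⁅ i ⁆ ∪ ⁅ j ⁆) τ
        (λ x∈ → [ (λ x∈i → subst (_∈ τ) (sym (Sub.x∈⁅y⁆⇒x≡y i x∈i)) i∈)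
                , (λ x∈j → subst (_∈ τ) (sym (Sub.x∈⁅y⁆⇒x≡y j x∈j)) j∈) ]′ (Sub.x∈p∪q⁻ ⁅ i ⁆ ⁅ j ⁆ x∈)) Δτ)
      (cong not (dec-false (i Fin.≟ j) i≢j))

    pair-face : ∀ τ → Clique E τ → ∣ τ ∣ ≡ 2 → Δ τ ≡ true
    pair-face τ clique ∣τ∣≡2 with count-positive (lookup τ) (λ eq → contradiction (trans (sym size) eq) λ ())
      where
      size : count (lookup τ) ≡ + 2
      size = trans (sym (∣p∣≡∑ τ)) (cong +_ ∣τ∣≡2)
    ... | i , i∈ with count≡2 (lookup τ) (trans (sym (∣p∣≡∑ τ)) (cong +_ ∣τ∣≡2)) i i∈
    ...   | j , j∈ , j≢i , cover = proj₁ complex τ (⁅ i ⁆ ∪ ⁅ j ⁆)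
      (λ {x} x∈ → Sub.x∈p∪q⁺ (Sum.map (λ { refl → Sub.x∈⁅x⁆ i }) (λ { refl → Sub.x∈⁅x⁆ j }) (cover x ([]=⇒lookup x∈))))
      (proj₁ (∧-true (clique (lookup⇒[]= i τ i∈) (lookup⇒[]= j τ j∈) (j≢i ∘ sym))))

    -- By induction all proper subsets of a clique are faces, so a clique that is not a face would
    -- be a minimal non-face. Flagness makes it a pair, and a pair that is a clique is an edge.
    clique⇒face : ∀ τ → Clique E τ → Δ τ ≡ true
    clique⇒face τ = go τ (⊂-wellFounded τ)
      where
      go : ∀ τ → Acc _⊂_ τ → Clique E τ → Δ τ ≡ true
      go τ (acc rs) clique with Δ τ in Δτ
      ... | true  = refl
      ... | false = trans (sym Δτ) (pair-face τ clique (flag τ Δτ λ ρ ρ⊂τ →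
        go ρ (rs ρ⊂τ) λ i∈ j∈ → clique (proj₁ ρ⊂τ i∈) (proj₁ ρ⊂τ j∈)))

    module Extremal (dim : HasDim Δ 3) (eulerian : IsEulerian Δ) where

      -- A face that admits no further vertex is a facet. The four-element face given by `HasDim` is
      -- a facet too, since no face is larger, so purity gives both the same size.
      extend-Δ : ∀ τ → Δ τ ≡ true → ∣ τ ∣ ℕ.< 4 → ∃ λ i → i ∉ τ × Δ (τ ∪ ⁅ i ⁆) ≡ true
      extend-Δ τ Δτ ∣τ∣<4 with Fin.any? (λ i → ¬? (i Sub.∈? τ) ×-dec (Δ (τ ∪ ⁅ i ⁆) Bool.≟ true))
      ... | yes found = found
      ... | no  none  = contradiction (subst (ℕ._< 4) ∣τ∣≡4 ∣τ∣<4) (ℕ.<-irrefl refl)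
        where
        σ = proj₁ (proj₁ dim)
        σ-facet : IsFacet Δ σ
        σ-facet = proj₁ (proj₂ (proj₁ dim)) , λ ρ σ⊂ρ → Bool.¬-not λ Δρ →
          contradiction (ℕ.<-≤-trans (subst (ℕ._< ∣ ρ ∣) (proj₂ (proj₂ (proj₁ dim))) (Sub.p⊂q⇒∣p∣<∣q∣ σ⊂ρ)) (proj₂ dim ρ Δρ))
            (ℕ.<-irrefl refl)
        τ-facet : IsFacet Δ τ
        τ-facet = Δτ , λ { ρ (τ⊆ρ , x , x∈ρ , x∉τ) → Bool.¬-not λ Δρ → none (x , x∉τ , proj₁ complex (τ ∪ ⁅ x ⁆) ρ
          (λ y∈ → [ τ⊆ρ , (λ y∈x → subst (_∈ ρ) (sym (Sub.x∈⁅y⁆⇒x≡y x y∈x)) x∈ρ) ]′ (Sub.x∈p∪q⁻ τ ⁅ x ⁆ y∈)) Δρ) }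
        ∣τ∣≡4 : ∣ τ ∣ ≡ 4
        ∣τ∣≡4 = trans (proj₁ eulerian τ σ τ-facet σ-facet) (proj₂ (proj₂ (proj₁ dim)))

      Δ-FlagPure : FlagPure 4 true (λ _ → true) Δ
      Δ-FlagPure = record
        { face⇒ = λ τ Δτ → refl , (λ _ → refl) , face⇒clique τ Δτ
        ; face⇐ = λ τ _ _ → clique⇒face τ
        ; bounded = proj₂ dim
        ; extend = extend-Δ }

      lk₁ : ∀ v → FlagPure 3 true (E v) (lk Δ ⁅ v ⁆)
      lk₁ v = lk-vertex v Δ-FlagPure

      lk₂ : ∀ v a → FlagPure 2 (E v a) (λ i → E v i ∧ E a i) (lk (lk Δ ⁅ v ⁆) ⁅ a ⁆)
      lk₂ v a = lk-vertex a (lk₁ v)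

      open Counting E E-sym

      extend₁ : ∀ v → ∃ λ u → E v u ≡ true
      extend₁ v = FlagPure.extend-∅ (lk₁ v) refl (ℕ.s≤s ℕ.z≤n)

      extend₂ : ∀ v u → E v u ≡ true → ∃ λ x → E v x ∧ E u x ≡ true
      extend₂ v u vu = FlagPure.extend-∅ (lk₂ v u) vu (ℕ.s≤s ℕ.z≤n)

      -- A 5-clique would span a 4-dimensional face. In terms of links: after four vertex links the
      -- dimension bound leaves no face but the empty one, which is `bounded-0` up to reassociation.
      K₅-free : ∀ a b c d → clique₄ a b c d ≡ true → ∀ w → E a w ∧ E b w ∧ E c w ∧ E d w ≡ false
      K₅-free a b c d K w = trans assoc (trans (cong (_∧ N) (sym (trans (cong (clique₃ a b c ∧_) (Bool.∧-assoc (E a d) (E b d) (E c d))) K)))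
        (bounded-0 (lk-vertex d (lk-vertex c (lk₂ a b))) w))
        where
        N = ((E a w ∧ E b w) ∧ E c w) ∧ E d w
        assoc : E a w ∧ E b w ∧ E c w ∧ E d w ≡ N
        assoc = trans (sym (Bool.∧-assoc (E a w) (E b w) (E c w ∧ E d w))) (sym (Bool.∧-assoc (E a w ∧ E b w) (E c w) (E d w)))

      -- The link of a triangle is 0-dimensional, so its Euler relation says that the number of
      -- points minus 1 is 1.
      triangle-two : ∀ a b c → clique₃ a b c ≡ true → count (λ w → E a w ∧ E b w ∧ E c w) ≡ + 2
      triangle-two a b c abc = begin
        count N                                                ≡⟨ lemma (count N) ⟩
        (- 1ℤ * 1ℤ + count N) + (- 1ℤ * 0ℤ + 0ℤ) + 1ℤ         ≡⟨ cong (_+ 1ℤ) χ̃-lk ⟨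
        χ̃ (lk Δ σ) + 1ℤ                                       ≡⟨ cong (_+ 1ℤ) (trans (proj₂ eulerian σ Δσ)
                                                                  (cong sgn (FlagPure.maxSize≡ lkσ refl))) ⟩
        + 2                                                    ∎
        where
        N : Fin n → Bool
        N w = E a w ∧ E b w ∧ E c w
        ab = proj₁ (∧-true {E a b} abc)
        ac = proj₁ (∧-true {E a c} (proj₂ (∧-true {E a b} abc)))
        bc = proj₂ (∧-true {E a c} (proj₂ (∧-true {E a b} abc)))
        σ : Subset n
        σ = (⁅ a ⁆ ∪ ⁅ b ⁆) ∪ ⁅ c ⁆
        σ-cases : ∀ {i} → i ∈ σ → i ≡ a ⊎ i ≡ b ⊎ i ≡ c
        σ-cases i∈ with Sub.x∈p∪q⁻ (⁅ a ⁆ ∪ ⁅ b ⁆) ⁅ c ⁆ i∈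
        ... | inj₂ i∈c = inj₂ (inj₂ (Sub.x∈⁅y⁆⇒x≡y c i∈c))
        ... | inj₁ i∈ab with Sub.x∈p∪q⁻ ⁅ a ⁆ ⁅ b ⁆ i∈ab
        ...   | inj₁ i∈a = inj₁ (Sub.x∈⁅y⁆⇒x≡y a i∈a)
        ...   | inj₂ i∈b = inj₂ (inj₁ (Sub.x∈⁅y⁆⇒x≡y b i∈b))
        a∈ : a ∈ σ
        a∈ = Sub.x∈p∪q⁺ (inj₁ (Sub.x∈p∪q⁺ (inj₁ (Sub.x∈⁅x⁆ a))))
        b∈ : b ∈ σ
        b∈ = Sub.x∈p∪q⁺ (inj₁ (Sub.x∈p∪q⁺ (inj₂ (Sub.x∈⁅x⁆ b))))
        c∈ : c ∈ σ
        c∈ = Sub.x∈p∪q⁺ (inj₂ (Sub.x∈⁅x⁆ c))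
        σ-clique : Clique E σ
        σ-clique i∈ j∈ i≢j with σ-cases i∈ | σ-cases j∈
        ... | inj₁ refl        | inj₁ refl        = contradiction refl i≢j
        ... | inj₁ refl        | inj₂ (inj₁ refl) = ab
        ... | inj₁ refl        | inj₂ (inj₂ refl) = ac
        ... | inj₂ (inj₁ refl) | inj₁ refl        = trans (E-sym b a) ab
        ... | inj₂ (inj₁ refl) | inj₂ (inj₁ refl) = contradiction refl i≢j
        ... | inj₂ (inj₁ refl) | inj₂ (inj₂ refl) = bc
        ... | inj₂ (inj₂ refl) | inj₁ refl        = trans (E-sym c a) ac
        ... | inj₂ (inj₂ refl) | inj₂ (inj₁ refl) = trans (E-sym c b) bc
        ... | inj₂ (inj₂ refl) | inj₂ (inj₂ refl) = contradiction refl i≢j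
        Δσ : Δ σ ≡ true
        Δσ = clique⇒face σ σ-clique
        ∣σ∣≡3 : ∣ σ ∣ ≡ 3
        ∣σ∣≡3 = trans (∪-size (⁅ a ⁆ ∪ ⁅ b ⁆) c λ c∈ →
            [ (λ c∈a → E-≢ ac (sym (Sub.x∈⁅y⁆⇒x≡y a c∈a))) , (λ c∈b → E-≢ bc (sym (Sub.x∈⁅y⁆⇒x≡y b c∈b))) ]′ (Sub.x∈p∪q⁻ ⁅ a ⁆ ⁅ b ⁆ c∈))
          (cong suc (trans (∪-size ⁅ a ⁆ b λ b∈a → E-≢ ab (sym (Sub.x∈⁅y⁆⇒x≡y a b∈a)))
            (cong suc (Sub.∣⁅x⁆∣≡1 a))))
        lkσ : FlagPure 1 true N (lk Δ σ)
        lkσ = lk-FlagPure σ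
          (subst (λ k → FlagPure k true (λ _ → true) Δ) (cong suc (sym ∣σ∣≡3)) Δ-FlagPure)
          (λ _ → refl , (λ _ → refl) , σ-clique) (λ _ _ _ → refl)
          (λ i Ni → refl , λ v∈ → case σ-cases v∈ of λ
            { (inj₁ refl) → proj₁ (∧-true {E a i} Ni)
            ; (inj₂ (inj₁ refl)) → proj₁ (∧-true {E b i} (proj₂ (∧-true {E a i} Ni)))
            ; (inj₂ (inj₂ refl)) → proj₂ (∧-true {E b i} (proj₂ (∧-true {E a i} Ni))) })
          (λ i _ adj → true-∧ (adj a∈) (true-∧ (adj b∈) (adj c∈)))
        χ̃-lk : χ̃ (lk Δ σ) ≡ (- 1ℤ * 1ℤ + count N) + (- 1ℤ * 0ℤ + 0ℤ)
        χ̃-lk = trans (χ̃-dim≤2 (lk Δ σ) λ τ lkτ → ℕ.≤-trans (FlagPure.bounded lkσ τ lkτ) (ℕ.s≤s ℕ.z≤n))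
          (cong₂ _+_
            (cong₂ (λ x y → - 1ℤ * x + y)
              (trans (faceCount-0 (lk Δ σ)) (cong ⟦_⟧ (FlagPure.∅∈ lkσ)))
              (faceCount-1 lkσ))
            (cong₂ (λ x y → - 1ℤ * x + y)
              (faceCount-bounded lkσ 2 (ℕ.s≤s (ℕ.s≤s ℕ.z≤n)))
              (faceCount-bounded lkσ 3 (ℕ.s≤s (ℕ.s≤s ℕ.z≤n)))))
        lemma : ∀ x → x ≡ (- 1ℤ * 1ℤ + x) + (- 1ℤ * 0ℤ + 0ℤ) + 1ℤ
        lemma = solve-∀

      open Closed triangle-two

      -- `T₃ v` counts each edge of the link of `v` twice, and the link has 2 `T₃ v` ordered
      -- triangles since every edge has two completions. Six times the Euler relation of the
      -- 2-dimensional link is then -6 + 6d - 3T + 2T = 6, with d = `deg v` and T = `T₃ v`.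
      euler : ∀ v → T₃ v ≡ + 6 * deg v - + 12
      euler v = begin
        T₃ v
          ≡⟨ lemma (deg v) (T₃ v) ⟩
        + 6 * deg v - + 6 - (- + 6 + + 6 * deg v - + 3 * T₃ v + + 2 * T₃ v)
          ≡⟨ cong (λ x → + 6 * deg v - + 6 - x) six ⟩
        + 6 * deg v - + 6 - + 6
          ≡⟨ lemma′ (deg v) ⟩
        + 6 * deg v - + 12 ∎
        where
        Γ = lk Δ ⁅ v ⁆
        χ̃≡1 : χ̃ Γ ≡ 1ℤ
        χ̃≡1 = trans (proj₂ eulerian ⁅ v ⁆ (proj₂ complex v)) (cong sgn (FlagPure.maxSize≡ (lk₁ v) refl))
        F₀ : faceCount Γ 0 ≡ 1ℤ
        F₀ = trans (faceCount-0 Γ) (cong ⟦_⟧ (FlagPure.∅∈ (lk₁ v)))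
        F₃ : + 6 * faceCount Γ 3 ≡ + 2 * T₃ v
        F₃ = begin
          + 6 * faceCount Γ 3 ≡⟨ faceCount-3 (lk₁ v) ⟩
          ∑ (λ a → ∑ λ b → ∑ λ d → ⟦ clique₃ v a b ∧ ((E v d ∧ E a d) ∧ E b d) ⟧)
            ≡⟨ ∑³-cong (λ a b d → trans (cong (λ p → ⟦ clique₃ v a b ∧ p ⟧) (Bool.∧-assoc (E v d) (E a d) (E b d))) (sym (ℤ.*-identityʳ _))) ⟩
          ∑ (λ a → ∑ λ b → ∑ λ d → ⟦ clique₄ v a b d ⟧ * 1ℤ)
            ≡⟨ ∑-clique₄-const v 1ℤ ⟩
          + 2 * (T₃ v * 1ℤ)
            ≡⟨ cong (+ 2 *_) (ℤ.*-identityʳ (T₃ v)) ⟩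
          + 2 * T₃ v ∎
        six : - + 6 + + 6 * deg v - + 3 * T₃ v + + 2 * T₃ v ≡ + 6
        six = begin
          - + 6 + + 6 * deg v - + 3 * T₃ v + + 2 * T₃ v
            ≡⟨ cong₂ (λ x y → - + 6 + + 6 * deg v - + 3 * x + y) (faceCount-2 (lk₁ v)) F₃ ⟨
          - + 6 + + 6 * deg v - + 3 * (+ 2 * faceCount Γ 2) + + 6 * faceCount Γ 3
            ≡⟨ collect (deg v) (faceCount Γ 2) (faceCount Γ 3) ⟩
          + 6 * ((- 1ℤ * 1ℤ + deg v) + (- 1ℤ * faceCount Γ 2 + faceCount Γ 3))
            ≡⟨ cong₂ (λ x y → + 6 * ((- 1ℤ * x + y) + (- 1ℤ * faceCount Γ 2 + faceCount Γ 3))) F₀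
                 (faceCount-1 (lk₁ v)) ⟨
          + 6 * ((- 1ℤ * faceCount Γ 0 + faceCount Γ 1) + (- 1ℤ * faceCount Γ 2 + faceCount Γ 3))
            ≡⟨ cong (+ 6 *_) (trans (sym (χ̃-dim≤2 Γ (FlagPure.bounded (lk₁ v)))) χ̃≡1) ⟩
          + 6 ∎
          where
          collect : ∀ d x y → - + 6 + + 6 * d - + 3 * (+ 2 * x) + + 6 * y ≡ + 6 * ((- 1ℤ * 1ℤ + d) + (- 1ℤ * x + y))
          collect = solve-∀
        lemma : ∀ d t → t ≡ + 6 * d - + 6 - (- + 6 + + 6 * d - + 3 * t + + 2 * t)
        lemma = solve-∀
        lemma′ : ∀ d → + 6 * d - + 6 - + 6 ≡ + 6 * d - + 12
        lemma′ = solve-∀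

      ∑deg≡2f₁ : ∑ deg ≡ + 2 * + f₁ Δ
      ∑deg≡2f₁ = trans (sym (faceCount-2 Δ-FlagPure)) (cong (+ 2 *_) (sym (f₁≡faceCount Δ)))

      -- Recognising the join of two unions of cycles

      module Assemble (P Q : Fin n → Bool) (Q≡¬P : ∀ x → Q x ≡ not (P x))
        (P-two : TwoRegular P) (Q-two : TwoRegular Q) (P-Q : ∀ x y → P x ≡ true → Q y ≡ true → E x y ≡ true) where

        module DP = CycleDecomposition (decompose P P-two)
        module DQ = CycleDecomposition (decompose Q Q-two)

        CycV² : Set
        CycV² = CycV DP.lengths ⊎ CycV DQ.lengths

        φ : CycV² → Fin n
        φ (inj₁ u) = DP.φ u
        φ (inj₂ u) = DQ.φ u

        disjoint : ∀ {x} → P x ≡ true → Q x ≡ true → ∀ {A : Set} → A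
        disjoint {x} Px Qx = contradiction (trans (sym Qx) (trans (Q≡¬P x) (cong not Px))) λ ()

        φ-injective : ∀ u v → φ u ≡ φ v → u ≡ v
        φ-injective (inj₁ u) (inj₁ v) eq = cong inj₁ (DP.injective u v eq)
        φ-injective (inj₁ u) (inj₂ v) eq = disjoint (subst (λ x → P x ≡ true) eq (DP.φ∈R u)) (DQ.φ∈R v)
        φ-injective (inj₂ u) (inj₁ v) eq = disjoint (subst (λ x → P x ≡ true) (sym eq) (DP.φ∈R v)) (DQ.φ∈R u)
        φ-injective (inj₂ u) (inj₂ v) eq = cong inj₂ (DQ.injective u v eq)

        φ-surjective : ∀ x → ∃ λ u → φ u ≡ x
        φ-surjective x with P x in Px
        ... | true  = let u , eq = DP.surjective x Px in inj₁ u , eq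
        ... | false = let u , eq = DQ.surjective x (trans (Q≡¬P x) (cong not Px)) in inj₂ u , eq

        vertices : Fin n ↔ CycV²
        vertices = mk↔ₛ′ (proj₁ ∘ φ-surjective) φ
          (λ u → φ-injective _ _ (proj₂ (φ-surjective (φ u)))) (proj₂ ∘ φ-surjective)

        cuFace : ∀ {R} (R-two : TwoRegular R) (D : CycleDecomposition R) → let module D = CycleDecomposition D in
          ∀ σ → Clique E σ → CUFace D.lengths (λ u → D.φ u ∈ σ)
        cuFace R-two D σ clique = at-most-two , λ u v u∈ v∈ u≢v → D.adj⇒ u v (clique u∈ v∈ λ eq → u≢v (D.injective u v eq))
          where
          module D = CycleDecomposition D
          at-most-two : ∀ u v w → D.φ u ∈ σ → D.φ v ∈ σ → D.φ w ∈ σ → u ≡ v ⊎ v ≡ w ⊎ u ≡ w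
          at-most-two u v w u∈ v∈ w∈ with D.φ u Fin.≟ D.φ v | D.φ v Fin.≟ D.φ w | D.φ u Fin.≟ D.φ w
          ... | yes eq | _      | _      = inj₁ (D.injective u v eq)
          ... | no _   | yes eq | _      = inj₂ (inj₁ (D.injective v w eq))
          ... | no _   | no _   | yes eq = inj₂ (inj₂ (D.injective u w eq))
          -- Triangle-freeness is what keeps each side of the join 1-dimensional.
          ... | no u≢v | no v≢w | no u≢w = contradiction
            (trans (sym (true-∧ (clique u∈ v∈ u≢v) (true-∧ (clique u∈ w∈ u≢w) (clique v∈ w∈ v≢w))))
              (TwoRegular.triangle-free R-two _ _ _ (D.φ∈R u) (D.φ∈R v) (D.φ∈R w))) λ ()

        joinFace⇒edge : ∀ σ → JoinFace DP.lengths DQ.lengths (λ u → φ u ∈ σ) →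
          ∀ u v → φ u ∈ σ → φ v ∈ σ → φ u ≢ φ v → E (φ u) (φ v) ≡ true
        joinFace⇒edge σ ((_ , adj) , _) (inj₁ u) (inj₁ v) u∈ v∈ u≢v = DP.adj⇐ u v (adj u v u∈ v∈ λ eq → u≢v (cong DP.φ eq))
        joinFace⇒edge σ _ (inj₁ u) (inj₂ v) _ _ _ = P-Q _ _ (DP.φ∈R u) (DQ.φ∈R v)
        joinFace⇒edge σ _ (inj₂ u) (inj₁ v) _ _ _ = trans (E-sym _ _) (P-Q _ _ (DP.φ∈R v) (DQ.φ∈R u))
        joinFace⇒edge σ (_ , (_ , adj)) (inj₂ u) (inj₂ v) u∈ v∈ u≢v = DQ.adj⇐ u v (adj u v u∈ v∈ λ eq → u≢v (cong DQ.φ eq))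

        joinFace⇒clique : ∀ σ → JoinFace DP.lengths DQ.lengths (λ u → φ u ∈ σ) → Clique E σ
        joinFace⇒clique σ J {i} {j} i∈ j∈ i≢j with φ-surjective i | φ-surjective j
        ... | u , refl | v , refl = joinFace⇒edge σ J u v i∈ j∈ i≢j

        inGJ : count P ≡ + (n / 2) → count Q ≡ + (n ℕ.∸ n / 2) → InGJ n Δ
        inGJ #P #Q = DP.lengths , DQ.lengths , DP.lengths≥4 , DQ.lengths≥4 ,
          ℤ.+-injective (trans DP.sum≡count #P) , ℤ.+-injective (trans DQ.sum≡count #Q) , vertices ,
          λ σ → mk⇔
            (λ Δσ → cuFace P-two (decompose P P-two) σ (face⇒clique σ Δσ) , cuFace Q-two (decompose Q Q-two) σ (face⇒clique σ Δσ))
            (λ J → clique⇒face σ (joinFace⇒clique σ J))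

      theorem : f₁ Δ ≡ n ℕ.* n / 4 ℕ.+ n → InGJ n Δ
      -- `sizes` leaves open which side has ⌊n/2⌋ vertices, whereas the first list in `InGJ` must
      -- belong to that side; the two cases exchange the roles of `A` and `B`.
      theorem f₁≡ = [ (λ { (#A , #B) → Assemble.inGJ A B (λ x → sym (Bool.not-involutive (B x))) A-two B-two
                         (λ x y Ax By → trans (E-sym x y) (join x y Ax By)) (trans #A floor′) (trans #B ceiling′) })
                    , (λ { (#A , #B) → Assemble.inGJ B A (λ _ → refl) B-two A-two
                         (λ x y Bx Ay → join y x Ay Bx) (trans #B floor′) (trans #A ceiling′) }) ]′
                    (sizes (+ h) (+ h′) +n≡ deg-sum)
        where
        open Halves (halves n)
        floor′ : + h ≡ + (n / 2)
        floor′ = cong +_ floor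
        ceiling′ : + h′ ≡ + (n ℕ.∸ n / 2)
        ceiling′ = cong +_ ceiling
        +n≡ : + n ≡ + h + + h′
        +n≡ = trans (cong +_ n≡h+h′) (ℤ.pos-+ h h′)
        deg-sum : ∑ deg ≡ + 2 * (+ h * + h′ + + n)
        deg-sum = trans ∑deg≡2f₁ (cong (+ 2 *_) (trans (cong +_ (trans f₁≡ (cong (ℕ._+ n) quarter)))
          (trans (ℤ.pos-+ (h ℕ.* h′) n) (cong (_+ + n) (ℤ.pos-* h h′)))))
        tight = Counting.Closed.Extremal.slack≡0 E E-sym triangle-two euler (+ h) (+ h′) +n≡
          (Sum.map (λ eq → cong +_ eq) (λ eq → cong +_ (trans eq (ℕ.+-comm 1 h))) balanced) deg-sum
        open Links euler K₅-free extend₁ extend₂ tight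
        v₀ : Fin n
        -- The four-element face forces n ≥ 4, so there is a vertex and the maximal degree exists.
        v₀ = fromℕ< (ℕ.<-≤-trans (ℕ.s≤s ℕ.z≤n) (subst (ℕ._≤ n) (proj₂ (proj₂ (proj₁ dim))) (Sub.∣p∣≤n (proj₁ (proj₁ dim)))))
        poles = mutual-poles v₀
        open Join (proj₁ poles) (proj₁ (proj₂ poles)) (proj₁ (proj₂ (proj₂ poles)))
          (proj₁ (proj₂ (proj₂ (proj₂ poles)))) (proj₂ (proj₂ (proj₂ (proj₂ poles))))
        A-two : TwoRegular A
        A-two = record { regular = A-regular ; triangle-free = A-triangle-free }
        B-two : TwoRegular B
        B-two = record { regular = B-regular ; triangle-free = B-triangle-free }

open Extremality

open import Data.Nat using (ℕ; _+_; _*_; _/_)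

theorem5p10 : (n : ℕ) (Δ : Cx n) →
    IsComplex Δ → IsFlag Δ → HasDim Δ 3 → IsEulerian Δ →
    f₁ Δ ≡ n * n / 4 + n →
    InGJ n Δ
theorem5p10 n Δ complex flag dim eulerian = FlagComplex.Extremal.theorem Δ complex flag dim eulerian
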